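{- For all integers $n \geq 1$ and $0 \leq k \leq n-1$, $$\sum_{(\sigma,S)\in \mathfrak{S}^{>}_{n,k}} q^{\operatorname{inv}((\sigma,S))} = \sum_{(\sigma,S)\in \mathfrak{S}^{>}_{n,k}} q^{\operatorname{maj}((\sigma,S))} = \sum_{P\in\mathcal{M}_{n,k}} q^{\operatorname{unc}(P)} = [n-k]_q!\,S_{n,n-k}(q).$$
   Context: $\mathfrak{S}_n$ is the set of permutations $\sigma=\sigma_1\cdots\sigma_n$ of $\{1,\dots,n\}$. For $\sigma\in\mathfrak{S}_n$: $\operatorname{Des}(\sigma)=\{i\in\{1,\dots,n-1\}:\sigma_i>\sigma_{i+1}\}$, $\operatorname{maj}(\sigma)=\sum_{i\in\operatorname{Des}(\sigma)}i$, $\operatorname{inv}(\sigma)=|\{(i,j):1\le i<j\le n,\ \sigma_i>\sigma_j\}|$, and $\operatorname{inv}^{\Box,j}(\sigma)=|\{i: 1\le i<j,\ \sigma_i>\sigma_j\}|$. $\mathfrak{S}^{>}_{n,k}=\{(\sigma,S):\sigma\in\mathfrak{S}_n,\ S\subseteq\operatorname{Des}(\sigma),\ |S|=k\}$ (descent-starred permutations). For $(\sigma,S)\in\mathfrak{S}^{>}_{n,k}$, $$\operatorname{inv}((\sigma,S))=\operatorname{inv}(\sigma)-\sum_{i\in S}\big(1+\operatorname{inv}^{\Box,i}(\sigma)\big),\qquad \operatorname{maj}((\sigma,S))=\operatorname{maj}(\sigma)-\sum_{i\in S}|\operatorname{Des}(\sigma)\cap\{i,i+1,\dots,n-1\}|.$$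 Mixed rook placements. Let $St_n$ be the board whose $i$th column (from left, $i=1,\dots,n$) consists of $i$ cells, columns being bottom-justified and rows numbered $1,2,\dots$ from the bottom. $\mathcal{M}_{n,k}$ is the set of all placements $P=N\cup F$ of rooks in cells of $St_n$, where $N$ consists of $k$ rooks ("non-attacking rooks") and $F$ consists of $n-k$ rooks ("file rooks") (the type of each rook is part of the data), such that: (1) no rook of $N$ is in the first (bottom) row; (2) there is exactly one rook in each column; (3) each rook $r\in N$ cancels the cell it occupies, all cells in its row to the right of $r$, and all cells in its column that either lie above $r$ or lie in the first row; (4) each rook $f\in F$ cancels the cell it occupies and all cells in its column above $f$; (5) no rook lies in a cell canceled by another rook. In particular no two rooks of $N$ share a row or column. For $P\in\mathcal{M}_{n,k}$, $\operatorname{unc}(P)$ is the number of cells of $St_n$ not canceled by any rook of $P$. $[m]_q=1+q+\cdots+q^{m-1}$ and $[m]_q!=[1]_q[2]_q\cdots[m]_q$. The $q$-Stirling numbers $S_{n,k}(q)$ are defined by $S_{0,0}(q)=1$, $S_{n,k}(q)=0$ if $k<0$ or $k>n$, and $S_{n+1,k}(q)=S_{n,k-1}(q)+[k]_qS_{n,k}(q)$. -}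

module Defs where

open import Algebra.Bundles using (CommutativeSemiring)
open import Data.Bool.Base using (true; false)
open import Data.Fin.Base using (Fin; toℕ; _<_; _≤_)
open import Data.Fin.Properties using (_≟_; _<?_; _≤?_; any?; all?)
open import Data.Fin.Subset using (Subset; _∈_; _⊆_; _∩_; ∣_∣)
open import Data.Fin.Subset.Properties using (_∈?_; _⊆?_)
open import Data.List.Base as List
  using (List; []; _∷_; allFin; upTo; cartesianProduct; cartesianProductWith; filter; foldr; length)
open import Data.Nat.Base using (ℕ; zero; suc; _+_; _∸_)
import Data.Nat.Properties as ℕ
open import Data.Product.Base using (_×_; _,_; ∃-syntax; proj₁; proj₂)
open import Data.Sum.Base using (_⊎_)
open import Data.Vec.Base using (Vec; []; _∷_; lookup; tabulate)
open import Data.Vec.Relation.Unary.AllPairs using (allPairs?)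
open import Data.Vec.Relation.Unary.Unique.Propositional using (Unique)
open import Level using (Level)
open import Relation.Binary.Definitions using (DecidableEquality)
open import Relation.Binary.PropositionalEquality.Core using (_≡_; _≢_; refl)
open import Relation.Nullary.Decidable using (Dec; yes; no; does; map′; ¬?; _×-dec_; _⊎-dec_; _→-dec_)
open import Relation.Nullary.Negation.Core using (¬_)
open import Relation.Unary using (Pred; Decidable)

private
  variable
    a p : Level
    A : Set a
    n : ℕ

allVecs : List A → (n : ℕ) → List (Vec A n)
allVecs xs zero    = [] ∷ []
allVecs xs (suc n) = cartesianProductWith _∷_ xs (allVecs xs n)

comprehension : {P : Pred (Fin n) p} → Decidable P → Subset n
comprehension P? = tabulate (λ i → does (P? i))

sumOver : Subset n → (Fin n → ℕ) → ℕ
sumOver {n} S f = List.sum (List.map f (filter (_∈? S) (allFin n)))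

-- Letters, positions, rows and columns are elements of Fin n, so the element i
-- stands for the number 1 + toℕ i of {1, …, n}.

position : Fin n → ℕ
position i = suc (toℕ i)

------------------------------------------------------------------------
-- Descent-starred permutations

-- A word of length n over {1, …, n} is a permutation in one-line notation
-- exactly when its letters are pairwise distinct (`Unique`).

Word : ℕ → Set
Word n = Vec (Fin n) n

unique? : Decidable (Unique {A = Fin n} {n = n})
unique? = allPairs? (λ x y → ¬? (x ≟ y))

IsDescent : Word n → Fin n → Set
IsDescent σ i = ∃[ j ] (toℕ j ≡ suc (toℕ i) × lookup σ j < lookup σ i)

isDescent? : (σ : Word n) → Decidable (IsDescent σ)
isDescent? σ i = any? (λ j → (toℕ j ℕ.≟ suc (toℕ i)) ×-dec (lookup σ j <? lookup σ i))

Des : Word n → Subset n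
Des σ = comprehension (isDescent? σ)

maj : Word n → ℕ
maj σ = sumOver (Des σ) position

IsInversion : Word n → Fin n → Fin n → Set
IsInversion σ i j = i < j × lookup σ j < lookup σ i

isInversion? : (σ : Word n) (i j : Fin n) → Dec (IsInversion σ i j)
isInversion? σ i j = (i <? j) ×-dec (lookup σ j <? lookup σ i)

inv : Word n → ℕ
inv {n} σ = length (filter (λ (i , j) → isInversion? σ i j) (cartesianProduct (allFin n) (allFin n)))

inv□ : Word n → Fin n → ℕ
inv□ {n} σ j = length (filter (λ i → isInversion? σ i j) (allFin n))

Starred : ℕ → Set
Starred n = Word n × Subset n

IsStarred : ℕ → Starred n → Set
IsStarred k (σ , S) = Unique σ × S ⊆ Des σ × ∣ S ∣ ≡ k

isStarred? : (k : ℕ) → Decidable (IsStarred {n} k)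
isStarred? k (σ , S) = unique? σ ×-dec ((S ⊆? Des σ) ×-dec (∣ S ∣ ℕ.≟ k))

𝔖> : (n k : ℕ) → List (Starred n)
𝔖> n k = filter (isStarred? k) (cartesianProduct (allVecs (allFin n) n) (allVecs (true ∷ false ∷ []) n))

from : Fin n → Subset n
from i = comprehension (i ≤?_)

-- The subtractions in inv★ and maj★ never truncate when S ⊆ Des σ:
-- * inv σ is the sum of inv□ σ j over all j, and a descent i has
--   1 + inv□ σ i ≤ inv□ σ (i + 1);
-- * the sum subtracted from maj σ counts the pairs i ≤ d with i ∈ S and
--   d ∈ Des σ, and each d occurs in at most d of them.

inv★ : Starred n → ℕ
inv★ (σ , S) = inv σ ∸ sumOver S (λ i → 1 + inv□ σ i)

-- The last position is never a descent, so Des σ ∩ from i is Des σ ∩ {i, …, n - 1}.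

maj★ : Starred n → ℕ
maj★ (σ , S) = maj σ ∸ sumOver S (λ i → ∣ Des σ ∩ from i ∣)

------------------------------------------------------------------------
-- Mixed rook placements

data Kind : Set where
  nonAttacking file : Kind

_≟ᴷ_ : DecidableEquality Kind
nonAttacking ≟ᴷ nonAttacking = yes refl
nonAttacking ≟ᴷ file         = no λ ()
file         ≟ᴷ nonAttacking = no λ ()
file         ≟ᴷ file         = yes refl

-- A cell is a pair (column , row), rows being counted from the bottom.

Cell : ℕ → Set
Cell n = Fin n × Fin n

OnBoard : Cell n → Set
OnBoard (c , r) = r ≤ c

onBoard? : Decidable (OnBoard {n})
onBoard? (c , r) = r ≤? c

FirstRow : Fin n → Set
FirstRow r = toℕ r ≡ 0

firstRow? : Decidable (FirstRow {n})
firstRow? r = toℕ r ℕ.≟ 0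

-- Exactly one rook stands in each column: the entry at column c gives its kind and row.

Placement : ℕ → Set
Placement n = Vec (Kind × Fin n) n

kind : Placement n → Fin n → Kind
kind P c = proj₁ (lookup P c)

row : Placement n → Fin n → Fin n
row P c = proj₂ (lookup P c)

Cancels : Kind → Cell n → Cell n → Set
Cancels nonAttacking (c , r) (c′ , r′) =
  (c′ ≡ c × r′ ≡ r) ⊎ (r′ ≡ r × c < c′) ⊎ (c′ ≡ c × (r < r′ ⊎ FirstRow r′))
Cancels file (c , r) (c′ , r′) =
  (c′ ≡ c × r′ ≡ r) ⊎ (c′ ≡ c × r < r′)

cancels? : (t : Kind) (x y : Cell n) → Dec (Cancels t x y)
cancels? nonAttacking (c , r) (c′ , r′) =
  ((c′ ≟ c) ×-dec (r′ ≟ r)) ⊎-dec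
  (((r′ ≟ r) ×-dec (c <? c′)) ⊎-dec ((c′ ≟ c) ×-dec ((r <? r′) ⊎-dec firstRow? r′)))
cancels? file (c , r) (c′ , r′) =
  ((c′ ≟ c) ×-dec (r′ ≟ r)) ⊎-dec ((c′ ≟ c) ×-dec (r <? r′))

CancelledBy : Placement n → Fin n → Cell n → Set
CancelledBy P c = Cancels (kind P c) (c , row P c)

cancelledBy? : (P : Placement n) (c : Fin n) → Decidable (CancelledBy P c)
cancelledBy? P c = cancels? (kind P c) (c , row P c)

rooks : Kind → Placement n → Subset n
rooks t P = comprehension (λ c → kind P c ≟ᴷ t)

record IsMixed (k : ℕ) (P : Placement n) : Set where
  constructor isMixed
  field
    onBoard       : ∀ c → OnBoard (c , row P c)
    #nonAttacking : ∣ rooks nonAttacking P ∣ ≡ k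
    #file         : ∣ rooks file P ∣ ≡ n ∸ k
    notFirstRow   : ∀ c → kind P c ≡ nonAttacking → ¬ FirstRow (row P c)
    notCancelled  : ∀ c c′ → c ≢ c′ → ¬ CancelledBy P c (c′ , row P c′)

isMixed? : (k : ℕ) → Decidable (IsMixed {n} k)
isMixed? {n} k P = map′ (λ (b , x , y , f , u) → isMixed b x y f u)
                        (λ m → let open IsMixed m in
                               onBoard , #nonAttacking , #file , notFirstRow , notCancelled)
  (all? (λ c → onBoard? (c , row P c)) ×-dec
   ((∣ rooks nonAttacking P ∣ ℕ.≟ k) ×-dec
   ((∣ rooks file P ∣ ℕ.≟ n ∸ k) ×-dec
   (all? (λ c → (kind P c ≟ᴷ nonAttacking) →-dec ¬? (firstRow? (row P c))) ×-dec
    all? (λ c → all? (λ c′ → ¬? (c ≟ c′) →-dec ¬? (cancelledBy? P c (c′ , row P c′))))))))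

𝓜 : (n k : ℕ) → List (Placement n)
𝓜 n k = filter (isMixed? k)
  (allVecs (cartesianProduct (nonAttacking ∷ file ∷ []) (allFin n)) n)

unc : Placement n → ℕ
unc {n} P = length (filter (λ x → onBoard? x ×-dec ¬? (any? (λ c → cancelledBy? P c x)))
                           (cartesianProduct (allFin n) (allFin n)))

------------------------------------------------------------------------
-- q-analogues

-- An identity between polynomials in q with coefficients in ℕ is an identity
-- between the corresponding elements for every q in every commutative semiring;
-- the indeterminate of ℕ[q] is one such q.

module QAnalogue {c ℓ} (R : CommutativeSemiring c ℓ) (q : CommutativeSemiring.Carrier R) where

  open CommutativeSemiring R
    using (Carrier; 0#; 1#; semiring)
    renaming (_+_ to _⊕_; _*_ to _⊗_)
  open import Algebra.Properties.Semiring.Exp semiring using (_^_)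

  ∑ : List A → (A → Carrier) → Carrier
  ∑ xs f = foldr (λ x s → f x ⊕ s) 0# xs

  -- The sum of q ^ stat x over x ∈ xs.
  genFun : List A → (A → ℕ) → Carrier
  genFun xs stat = ∑ xs (λ x → q ^ stat x)

  [_]q : ℕ → Carrier
  [ m ]q = ∑ (upTo m) (q ^_)

  [_]q! : ℕ → Carrier
  [ zero ]q!  = 1#
  [ suc m ]q! = [ m ]q! ⊗ [ suc m ]q

  -- In the second and third clauses S_{0,k} with k > 0 and S_{n,-1} are zero; the
  -- recurrence then also gives S_{n,k} = 0 for all k > n.
  stirling : ℕ → ℕ → Carrier
  stirling zero    zero    = 1#
  stirling zero    (suc k) = 0#
  stirling (suc n) zero    = 0# ⊕ [ zero ]q ⊗ stirling n zero
  stirling (suc n) (suc k) = stirling n k ⊕ [ suc k ]q ⊗ stirling n (suc k)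

{-# OPTIONS --safe #-}

-- All the sums are values of the function T given by T(0,0) = 1, T(0,k) = 0 for k > 0 and
--   T(n+1,k) = [n+1-k] (T(n,k) + T(n,k-1)),
-- and so is [n-k]! S(n,n-k).
--
-- inv: inv★ (σ , S) is the number of inversions (i , j) with j ∉ S, less ∣ S ∣. Inserting the largest letter into
-- (σ , S) at a place that is not just behind a star adds one such inversion for each unstarred position to its right.
--
-- maj: maj★ (σ , S) is the sum of ∣ Des σ ∩ {i, i+1, …} ∣ over i ∉ S. Over the descents i, these numbers are 1, …, d
-- where d = ∣ Des σ ∣, so the sum over S is q^e times the elementary symmetric polynomial E(d,k) of degree d-k in
-- q, …, q^d, where e is the contribution of the non-descents. The recurrence then follows from Carlitz's insertion
-- of the largest letter and [k+1] q^(d-k) E(d,k+1) = [d-k] E(d,k).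
--
-- unc: filling the columns from left to right, a column with b+1 cells left contributes [b+1] for a file rook and
-- [b] for a non-attacking rook.
module Submission where

open import Defs
open import Algebra.Bundles using (CommutativeSemiring)
open import Data.Bool.Base using (Bool; true; false; not; _∧_; _∨_; if_then_else_)
open import Data.Bool.Properties using (∧-zeroʳ; ∧-identityʳ; ∧-assoc; T-≡)
open import Data.Fin.Base using (Fin; zero; suc; toℕ; inject₁; fromℕ; fromℕ<; lower₁; punchIn; punchOut)
import Data.Fin.Properties as Fin
open import Data.Fin.Subset using (Subset; ∣_∣; _∩_)
open import Data.Fin.Subset.Properties using (_∈?_; _⊆?_; ∣p∣≤n)
open import Data.List.Base as List
  using (List; []; _∷_; _++_; allFin; applyUpTo; cartesianProduct; cartesianProductWith; filter; length)
open import Data.List.Membership.Propositional using (_∈_)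
open import Data.List.Membership.Propositional.Properties
  using (∈-cartesianProductWith⁺; ∈-cartesianProductWith⁻; ∈-filter⁺; ∈-filter⁻; ∈-allFin)
open import Data.List.Membership.Propositional.Properties.WithK using (unique∧set⇒bag)
open import Data.List.Relation.Binary.BagAndSetEquality using (∼bag⇒↭)
open import Data.List.Relation.Binary.Permutation.Propositional as ↭ using (_↭_)
open import Data.List.Relation.Unary.All using ([])
open import Data.List.Relation.Unary.AllPairs using ([]; _∷_)
open import Data.List.Relation.Unary.Any using (here)
import Data.List.Relation.Unary.Unique.Propositional as List!
import Data.List.Relation.Unary.Unique.Propositional.Properties as List!
open import Data.Nat.Base as ℕ using (ℕ; zero; suc; _∸_; _≡ᵇ_; _<ᵇ_; _≤ᵇ_; z≤n; s≤s; _≤_)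
import Data.Nat.Properties as ℕ
open import Data.Product.Base using (_×_; _,_; ∃-syntax; ∃₂; proj₁; proj₂)
open import Data.Sum.Base using (_⊎_; inj₁; inj₂)
open import Data.Unit.Base using (⊤; tt)
open import Data.Vec.Base using (Vec; []; _∷_; insertAt; lookup; map; tabulate)
open import Data.Vec.Properties
  using (∷-injective; insertAt-lookup; insertAt-punchIn; lookup-map; lookup∘tabulate; map-cong; map-insertAt; map-∘;
         tabulate-cong; tabulate∘lookup)
open import Data.Vec.Relation.Unary.All using (All; []; _∷_)
open import Data.Vec.Relation.Unary.Unique.Propositional using (Unique)
open import Data.Vec.Relation.Unary.Unique.Propositional.Properties using (lookup-injective; tabulate⁺)
open import Function.Base using (_∘_; id)
open import Function.Bundles using (mk⇔; module Equivalence)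
open import Relation.Binary.PropositionalEquality as ≡ using (_≡_; _≢_)
open import Relation.Nullary.Decidable using (Dec; yes; no; does; ¬?; _×-dec_)
open import Relation.Nullary.Negation using (¬_; contradiction)
open import Relation.Unary using (Pred; Decidable)

-- For `inv★` and `maj★` the recurrence already holds for the insertions into one fixed σ, and
-- summing over σ gives that of T. For `inv★` its two terms are the largest letter without and with
-- a star. Both carry [n+1-k]: without a star there are n+1-k admissible places; with one the end is
-- excluded, but only k-1 positions were starred before. For `maj★` the sum over S is evaluated
-- first, for a fixed descent set, since the outcome depends on this set only through its size and
-- e, and insertion changes these two in a controlled way.
--
-- The rooks present an obstacle: the number of cells left in a column depends on all rooks before
-- it. Hence the columns are filled from the left with the number b of rows still open as a
-- parameter, while the recurrence of T splits off the last column; `rookSum-suc` passes from one to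
-- the other.
--
-- As q lies in an arbitrary commutative semiring, neither subtraction nor division is at hand.
-- Identities between quotients are therefore kept in multiplied-out form, and each truncated
-- subtraction in an exponent comes with the inequality that makes it exact.

bools : List Bool
bools = true ∷ false ∷ []

-- Guarded finite sums and q-integers

module Sums {c ℓ} (R : CommutativeSemiring c ℓ) (q : CommutativeSemiring.Carrier R) where

  open CommutativeSemiring R hiding (zero)
  open QAnalogue R q
  open import Algebra.Properties.Semiring.Exp semiring using (_^_; ^-homo-*; ^-congʳ)
  open import Algebra.Properties.Semiring.Sum semiring
    using (sum; sum-cong-≋; sum-replicate-zero; ∑-distrib-+; *-distribˡ-sum)
  open import Algebra.Solver.Ring.NaturalCoefficients.Default R using (solve; _:=_; _:+_; _:*_; con)
  open import Relation.Binary.Reasoning.Setoid setoid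

  -- Restricted sums are written as full sums of guarded terms, so that summations can be
  -- interchanged freely and a condition may be replaced by any Boolean of the same value.
  guard : Bool → Carrier → Carrier
  guard b x = if b then x else 0#

  guard-cong : ∀ b {x y} → (b ≡ true → x ≈ y) → guard b x ≈ guard b y
  guard-cong true  x≈y = x≈y ≡.refl
  guard-cong false x≈y = refl

  guard-congˡ : ∀ {a b} x → a ≡ b → guard a x ≈ guard b x
  guard-congˡ x ≡.refl = refl

  guard-∧ : ∀ a b x → guard (a ∧ b) x ≈ guard a (guard b x)
  guard-∧ true  b x = refl
  guard-∧ false b x = refl

  guard-0 : ∀ b → guard b 0# ≈ 0#
  guard-0 true  = refl
  guard-0 false = refl

  guard-+ : ∀ b x y → guard b (x + y) ≈ guard b x + guard b y
  guard-+ true  x y = refl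
  guard-+ false x y = sym (+-identityˡ 0#)

  guard-* : ∀ b x y → guard b (x * y) ≈ x * guard b y
  guard-* true  x y = refl
  guard-* false x y = sym (zeroʳ x)

  guard-split : ∀ b x → x ≈ guard (not b) x + guard b x
  guard-split true  x = sym (+-identityˡ x)
  guard-split false x = sym (+-identityʳ x)

  guard-sum : ∀ b n (f : Fin n → Carrier) → guard b (sum f) ≈ sum (λ i → guard b (f i))
  guard-sum true  n f = refl
  guard-sum false n f = sym (sum-replicate-zero n)

  sum-cong : ∀ n {f g : Fin n → Carrier} → (∀ i → f i ≈ g i) → sum f ≈ sum g
  sum-cong n = sum-cong-≋

  sum-*ˡ : ∀ n x (f : Fin n → Carrier) → sum (λ i → x * f i) ≈ x * sum f
  sum-*ˡ n x f = sym (*-distribˡ-sum x f)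

  sum-+ : ∀ n (f g : Fin n → Carrier) → sum (λ i → f i + g i) ≈ sum f + sum g
  sum-+ n = ∑-distrib-+

  sum-zero : ∀ n {f : Fin n → Carrier} → (∀ i → f i ≈ 0#) → sum f ≈ 0#
  sum-zero n f≈0 = trans (sum-cong n f≈0) (sum-replicate-zero n)

  module _ {a} {A : Set a} where

    ∑-cong : ∀ (xs : List A) {f g} → (∀ x → f x ≈ g x) → ∑ xs f ≈ ∑ xs g
    ∑-cong []       f≈g = refl
    ∑-cong (x ∷ xs) f≈g = +-cong (f≈g x) (∑-cong xs f≈g)

    ∑-++ : ∀ (xs ys : List A) f → ∑ (xs ++ ys) f ≈ ∑ xs f + ∑ ys f
    ∑-++ []       ys f = sym (+-identityˡ _)
    ∑-++ (x ∷ xs) ys f = trans (+-congˡ (∑-++ xs ys f)) (sym (+-assoc _ _ _))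

    ∑-0 : ∀ (xs : List A) {f} → (∀ x → f x ≈ 0#) → ∑ xs f ≈ 0#
    ∑-0 []       f≈0 = refl
    ∑-0 (x ∷ xs) f≈0 = trans (+-cong (f≈0 x) (∑-0 xs f≈0)) (+-identityˡ 0#)

    ∑-+ : ∀ (xs : List A) f g → ∑ xs (λ x → f x + g x) ≈ ∑ xs f + ∑ xs g
    ∑-+ []       f g = sym (+-identityˡ 0#)
    ∑-+ (x ∷ xs) f g = trans (+-congˡ (∑-+ xs f g))
      (solve 4 (λ a b c d → (a :+ b) :+ (c :+ d) := (a :+ c) :+ (b :+ d)) refl
        (f x) (g x) (∑ xs f) (∑ xs g))

    ∑-*ˡ : ∀ (xs : List A) y f → ∑ xs (λ x → y * f x) ≈ y * ∑ xs f
    ∑-*ˡ []       y f = sym (zeroʳ y)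
    ∑-*ˡ (x ∷ xs) y f = trans (+-congˡ (∑-*ˡ xs y f)) (sym (distribˡ y _ _))

    ∑-guard : ∀ (xs : List A) b f → ∑ xs (λ x → guard b (f x)) ≈ guard b (∑ xs f)
    ∑-guard xs true  f = refl
    ∑-guard xs false f = ∑-0 xs (λ _ → refl)

    ∑-sum-comm : ∀ (xs : List A) {n} (f : A → Fin n → Carrier) →
                 ∑ xs (λ x → sum (f x)) ≈ sum (λ i → ∑ xs (λ x → f x i))
    ∑-sum-comm []       {n} f = sym (sum-replicate-zero n)
    ∑-sum-comm (x ∷ xs) {n} f = trans (+-congˡ (∑-sum-comm xs f)) (sym (sum-+ n _ _))

    ∑-↭ : ∀ {xs ys : List A} f → xs ↭ ys → ∑ xs f ≈ ∑ ys f
    ∑-↭ f ↭.refl           = refl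
    ∑-↭ f (↭.prep x p)     = +-congˡ (∑-↭ f p)
    ∑-↭ f (↭.swap {ys = ys} x y p) = trans (+-congˡ (+-congˡ (∑-↭ f p)))
      (solve 3 (λ a b c → a :+ (b :+ c) := b :+ (a :+ c)) refl (f x) (f y) (∑ ys f))
    ∑-↭ f (↭.trans p₁ p₂)  = trans (∑-↭ f p₁) (∑-↭ f p₂)

    ∑-filter : ∀ {p} {P : Pred A p} (P? : Decidable P) xs f →
               ∑ (filter P? xs) f ≈ ∑ xs (λ x → guard (does (P? x)) (f x))
    ∑-filter P? []       f = refl
    ∑-filter P? (x ∷ xs) f with does (P? x)
    ... | true  = +-congˡ (∑-filter P? xs f)
    ... | false = trans (∑-filter P? xs f) (sym (+-identityˡ _))

    ∑-tabulate : ∀ {n} (g : Fin n → A) f → ∑ (List.tabulate g) f ≈ sum (λ i → f (g i))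
    ∑-tabulate {zero}  g f = refl
    ∑-tabulate {suc n} g f = +-congˡ (∑-tabulate (g ∘ suc) f)

  ∑-map : ∀ {a b} {A : Set a} {B : Set b} (h : A → B) xs f → ∑ (List.map h xs) f ≈ ∑ xs (λ x → f (h x))
  ∑-map h []       f = refl
  ∑-map h (x ∷ xs) f = +-congˡ (∑-map h xs f)

  ∑-allFin : ∀ n f → ∑ (allFin n) f ≈ sum f
  ∑-allFin n = ∑-tabulate {n = n} id

  ∑-cartesianProductWith : ∀ {a b c} {A : Set a} {B : Set b} {C : Set c} (h : A → B → C) xs ys f →
    ∑ (cartesianProductWith h xs ys) f ≈ ∑ xs (λ x → ∑ ys (λ y → f (h x y)))
  ∑-cartesianProductWith h []       ys f = refl
  ∑-cartesianProductWith h (x ∷ xs) ys f = begin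
    ∑ (List.map (h x) ys ++ cartesianProductWith h xs ys) f          ≈⟨ ∑-++ (List.map (h x) ys) _ f ⟩
    ∑ (List.map (h x) ys) f + ∑ (cartesianProductWith h xs ys) f     ≈⟨ +-cong (∑-map (h x) ys f) (∑-cartesianProductWith h xs ys f) ⟩
    ∑ ys (λ y → f (h x y)) + ∑ xs (λ x → ∑ ys (λ y → f (h x y)))     ∎

  ∑-square : ∀ n (f : Fin n × Fin n → Carrier) →
             ∑ (cartesianProduct (allFin n) (allFin n)) f ≈ sum (λ i → sum (λ j → f (i , j)))
  ∑-square n f = begin
    ∑ (cartesianProduct (allFin n) (allFin n)) f             ≈⟨ ∑-cartesianProductWith _,_ (allFin n) (allFin n) f ⟩
    ∑ (allFin n) (λ i → ∑ (allFin n) (λ j → f (i , j)))       ≈⟨ ∑-allFin n _ ⟩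
    sum (λ i → ∑ (allFin n) (λ j → f (i , j)))                ≈⟨ sum-cong n (λ i → ∑-allFin n _) ⟩
    sum (λ i → sum (λ j → f (i , j)))                         ∎

  ∑-allVecs-suc : ∀ {a} {A : Set a} (xs : List A) {n} f →
    ∑ (allVecs xs (suc n)) f ≈ ∑ xs (λ x → ∑ (allVecs xs n) (λ v → f (x ∷ v)))
  ∑-allVecs-suc xs {n} f = ∑-cartesianProductWith _∷_ xs (allVecs xs n) f

  ∑Subset : ∀ n → (Subset n → Carrier) → Carrier
  ∑Subset n = ∑ (allVecs bools n)

  ∑Subset-suc : ∀ n F → ∑Subset (suc n) F ≈ ∑Subset n (F ∘ (true ∷_)) + ∑Subset n (F ∘ (false ∷_))
  ∑Subset-suc n F = trans (∑-allVecs-suc bools {n} F) (+-congˡ (+-identityʳ _))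

  -- For a fixed p each subset arises from exactly one pair of a smaller subset and a bit at p. This
  -- lets the stars move along when a letter enters at p.
  ∑Subset-insertAt : ∀ {n} (p : Fin (suc n)) F → ∑Subset (suc n) F ≈
    ∑Subset n (λ S → F (insertAt S p true)) + ∑Subset n (λ S → F (insertAt S p false))
  ∑Subset-insertAt {n}     zero    F = ∑Subset-suc n F
  ∑Subset-insertAt {suc n} (suc p) F = begin
    ∑Subset (suc (suc n)) F
      ≈⟨ ∑Subset-suc (suc n) F ⟩
    ∑Subset (suc n) (F ∘ (true ∷_)) + ∑Subset (suc n) (F ∘ (false ∷_))
      ≈⟨ +-cong (∑Subset-insertAt p _) (∑Subset-insertAt p _) ⟩
    (G true true + G true false) + (G false true + G false false)
      ≈⟨ solve 4 (λ a b c d → (a :+ b) :+ (c :+ d) := (a :+ c) :+ (b :+ d)) refl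
           (G true true) (G true false) (G false true) (G false false) ⟩
    (G true true + G false true) + (G true false + G false false)
      ≈⟨ +-cong (∑Subset-suc n _) (∑Subset-suc n _) ⟨
    _ ∎
    where
    G : Bool → Bool → Carrier
    G t s = ∑Subset n (λ S → F (t ∷ insertAt S p s))

  ∑-applyUpTo : ∀ (g : ℕ → ℕ) m f → ∑ (applyUpTo g m) f ≈ sum {m} (λ i → f (g (toℕ i)))
  ∑-applyUpTo g zero    f = refl
  ∑-applyUpTo g (suc m) f = +-congˡ (∑-applyUpTo (g ∘ suc) m f)

  []q-suc : ∀ m → [ suc m ]q ≈ 1# + q * [ m ]q
  []q-suc m = +-congˡ (begin
    ∑ (applyUpTo suc m) (q ^_)               ≈⟨ ∑-applyUpTo suc m (q ^_) ⟩
    sum {m} (λ i → q * q ^ toℕ i)            ≈⟨ sum-*ˡ m q _ ⟩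
    q * sum {m} (λ i → q ^ toℕ i)            ≈⟨ *-congˡ (∑-applyUpTo id m (q ^_)) ⟨
    q * [ m ]q                               ∎)

  []q-+ : ∀ m n → [ m ℕ.+ n ]q ≈ [ m ]q + q ^ m * [ n ]q
  []q-+ zero    n = sym (trans (+-identityˡ _) (*-identityˡ _))
  []q-+ (suc m) n = begin
    [ suc (m ℕ.+ n) ]q                             ≈⟨ []q-suc (m ℕ.+ n) ⟩
    1# + q * [ m ℕ.+ n ]q                          ≈⟨ +-congˡ (*-congˡ ([]q-+ m n)) ⟩
    1# + q * ([ m ]q + q ^ m * [ n ]q)             ≈⟨ solve 4 (λ q a b c → con 1 :+ q :* (a :+ b :* c) := (con 1 :+ q :* a) :+ (q :* b) :* c) refl q [ m ]q (q ^ m) [ n ]q ⟩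
    (1# + q * [ m ]q) + q ^ suc m * [ n ]q         ≈⟨ +-congʳ ([]q-suc m) ⟨
    [ suc m ]q + q ^ suc m * [ n ]q                ∎

  [1]q : [ 1 ]q ≈ 1#
  [1]q = +-identityʳ 1#

  []q-sucʳ : ∀ m → [ suc m ]q ≈ [ m ]q + q ^ m
  []q-sucʳ m = begin
    [ suc m ]q                ≡⟨ ≡.cong [_]q (ℕ.+-comm 1 m) ⟩
    [ m ℕ.+ 1 ]q              ≈⟨ []q-+ m 1 ⟩
    [ m ]q + q ^ m * [ 1 ]q   ≈⟨ +-congˡ (trans (*-congˡ [1]q) (*-identityʳ _)) ⟩
    [ m ]q + q ^ m            ∎
    where import Data.Nat.Properties as ℕ

-- Over ℕ the guarded sums of ones are cardinalities, so the same lemmas count inversions, cells and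
-- rows.
module ℕΣ = Sums ℕ.+-*-commutativeSemiring 0

-- Descent sets, stars and insertion of a largest letter

module StarredPermutations where

  open ≡ using (_≡_; _≢_; refl; sym; trans; cong; cong₂; subst; subst₂; module ≡-Reasoning)
  open import Data.Nat.Base using (_+_)
  open import Algebra.Properties.Semiring.Sum ℕ.+-*-semiring using (sum; ∑-comm)
  open QAnalogue ℕ.+-*-commutativeSemiring 0 using (∑)

  -- Inclusion as a Boolean computed along both vectors: it can head a `guard`, and it splits under
  -- `insertAt`.
  _⊑ᵇ_ : ∀ {n} → Subset n → Subset n → Bool
  []      ⊑ᵇ []      = true
  (s ∷ S) ⊑ᵇ (d ∷ D) = (not s ∨ d) ∧ (S ⊑ᵇ D)

  -- Letters are natural numbers here: tails of permutations are then words of the same sort, and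
  -- inserting a larger letter leaves the type of the others unchanged.
  descents : ∀ {n} → Vec ℕ n → Subset n
  descents []          = []
  descents (x ∷ [])    = false ∷ []
  descents (x ∷ y ∷ w) = (y <ᵇ x) ∷ descents (y ∷ w)

  -- The property of descent sets that keeps the later differences from truncating: it leaves at
  -- most n-1 descents and, on a nonempty word, at least one unstarred position.
  LastOut : ∀ {n} → Subset n → Set
  LastOut []          = ⊤
  LastOut (d ∷ [])    = d ≡ false
  LastOut (d ∷ e ∷ D) = LastOut (e ∷ D)

  descents-lastOut : ∀ {n} (w : Vec ℕ n) → LastOut (descents w)
  descents-lastOut []              = tt
  descents-lastOut (x ∷ [])        = refl
  descents-lastOut (x ∷ y ∷ [])    = refl
  descents-lastOut (x ∷ y ∷ z ∷ w) = descents-lastOut (y ∷ z ∷ w)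

  ⊑ᵇ-lastOut : ∀ {n} (S D : Subset n) → S ⊑ᵇ D ≡ true → LastOut D → LastOut S
  ⊑ᵇ-lastOut []              []              _   _   = tt
  ⊑ᵇ-lastOut (false ∷ [])    (d ∷ [])        _   _   = refl
  ⊑ᵇ-lastOut (true ∷ [])     (true ∷ [])     _   ()
  ⊑ᵇ-lastOut (true ∷ [])     (false ∷ [])    ()  _
  ⊑ᵇ-lastOut (false ∷ t ∷ S) (d ∷ e ∷ D)     S⊑D out = ⊑ᵇ-lastOut (t ∷ S) (e ∷ D) S⊑D out
  ⊑ᵇ-lastOut (true ∷ t ∷ S)  (true ∷ e ∷ D)  S⊑D out = ⊑ᵇ-lastOut (t ∷ S) (e ∷ D) S⊑D out
  ⊑ᵇ-lastOut (true ∷ t ∷ S)  (false ∷ e ∷ D) ()  _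

  lastOut⇒∣∣< : ∀ {n} (D : Subset (suc n)) → LastOut D → ∣ D ∣ ℕ.< suc n
  lastOut⇒∣∣< (false ∷ D)     _   = s≤s (∣p∣≤n D)
  lastOut⇒∣∣< (true ∷ [])     ()
  lastOut⇒∣∣< (true ∷ d ∷ D)  out = s≤s (lastOut⇒∣∣< (d ∷ D) out)

  -- How the descent set changes when a letter larger than all the others is inserted.
  insertDescent : ∀ {n} → Fin (suc n) → Subset n → Subset (suc n)
  insertDescent zero          []      = false ∷ []
  insertDescent zero          (d ∷ D) = true ∷ d ∷ D
  insertDescent (suc zero)    (d ∷ D) = false ∷ insertDescent zero D
  insertDescent (suc (suc p)) (d ∷ D) = d ∷ insertDescent (suc p) D

  <⇒<ᵇ≡true : ∀ {m n} → m ℕ.< n → (m <ᵇ n) ≡ true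
  <⇒<ᵇ≡true {zero}  (s≤s _)   = refl
  <⇒<ᵇ≡true {suc m} (s≤s m<n) = <⇒<ᵇ≡true m<n

  <⇒>ᵇ≡false : ∀ {m n} → m ℕ.< n → (n <ᵇ m) ≡ false
  <⇒>ᵇ≡false {zero}  (s≤s _)   = refl
  <⇒>ᵇ≡false {suc m} (s≤s m<n) = <⇒>ᵇ≡false m<n

  descents-insertAt : ∀ {n} (w : Vec ℕ n) (p : Fin (suc n)) {M} → All (ℕ._< M) w →
                      descents (insertAt w p M) ≡ insertDescent p (descents w)
  descents-insertAt []          zero          []         = refl
  descents-insertAt (x ∷ [])    zero          (x<M ∷ _)  rewrite <⇒<ᵇ≡true x<M  = refl
  descents-insertAt (x ∷ y ∷ w) zero          (x<M ∷ _)  rewrite <⇒<ᵇ≡true x<M  = refl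
  descents-insertAt (x ∷ [])    (suc zero)    (x<M ∷ _)  rewrite <⇒>ᵇ≡false x<M = refl
  descents-insertAt (x ∷ y ∷ w) (suc zero)    (x<M ∷ w<M) rewrite <⇒>ᵇ≡false x<M =
    cong (false ∷_) (descents-insertAt (y ∷ w) zero w<M)
  descents-insertAt (x ∷ y ∷ w) (suc (suc p)) (_ ∷ w<M)  = cong (_ ∷_) (descents-insertAt (y ∷ w) (suc p) w<M)

  -- Gap p lies in front of letter p, so the star that matters is the one on letter p-1: a larger
  -- letter put behind it would turn its descent into an ascent.
  isFree : ∀ {n} → Subset n → Fin (suc n) → Bool
  isFree S       zero          = true
  isFree (s ∷ S) (suc zero)    = not s
  isFree (s ∷ S) (suc (suc p)) = isFree S (suc p)

  notLast : ∀ {n} → Fin (suc n) → Bool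
  notLast {zero}  p       = false
  notLast {suc n} zero    = true
  notLast {suc n} (suc p) = notLast p

  -- Only two positions are affected: the letter before the gap is no longer a descent, and the new
  -- letter is one unless it stands last. Before a free gap there is no star, so inclusion at that
  -- position is vacuous on both sides.
  insert-⊑ᵇ : ∀ {n} (S D : Subset n) (p : Fin (suc n)) s →
              insertAt S p s ⊑ᵇ insertDescent p D ≡ (S ⊑ᵇ D) ∧ (isFree S p ∧ (not s ∨ notLast p))
  insert-⊑ᵇ []      []      zero       true  = refl
  insert-⊑ᵇ []      []      zero       false = refl
  insert-⊑ᵇ (t ∷ S) (d ∷ D) zero       true  = sym (∧-identityʳ _)
  insert-⊑ᵇ (t ∷ S) (d ∷ D) zero       false = sym (∧-identityʳ _)
  insert-⊑ᵇ (true ∷ S)  (d ∷ D) (suc zero) s = sym (∧-zeroʳ _)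
  insert-⊑ᵇ (false ∷ S) (d ∷ D) (suc zero) s = insert-⊑ᵇ S D zero s
  insert-⊑ᵇ (t ∷ S) (d ∷ D) (suc (suc p)) s = trans
    (cong ((not t ∨ d) ∧_) (insert-⊑ᵇ S D (suc p) s))
    (sym (∧-assoc (not t ∨ d) (S ⊑ᵇ D) _))

  unstarred : ∀ {n} → Subset n → ℕ
  unstarred []          = 0
  unstarred (true ∷ S)  = unstarred S
  unstarred (false ∷ S) = suc (unstarred S)

  unstarred≡n∸∣∣ : ∀ {n} (S : Subset n) → unstarred S ≡ n ∸ ∣ S ∣
  unstarred≡n∸∣∣ []          = refl
  unstarred≡n∸∣∣ (true ∷ S)  = unstarred≡n∸∣∣ S
  unstarred≡n∸∣∣ (false ∷ S) = trans (cong suc (unstarred≡n∸∣∣ S)) (sym (ℕ.+-∸-assoc 1 (∣p∣≤n S)))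

  unstarredFrom : ∀ {n} → Subset n → Fin (suc n) → ℕ
  unstarredFrom S       zero    = unstarred S
  unstarredFrom (s ∷ S) (suc p) = unstarredFrom S p

  lastOut⇒unstarred>0 : ∀ {n} (S : Subset (suc n)) → LastOut S → 0 ℕ.< unstarred S
  lastOut⇒unstarred>0 (false ∷ S)    _   = s≤s z≤n
  lastOut⇒unstarred>0 (true ∷ [])    ()
  lastOut⇒unstarred>0 (true ∷ s ∷ S) out = lastOut⇒unstarred>0 (s ∷ S) out

  lastOut-tail : ∀ {n} s (S : Subset n) → LastOut (s ∷ S) → LastOut S
  lastOut-tail s []      _   = tt
  lastOut-tail s (t ∷ S) out = out

  -- The last position carries no star and lies behind every gap but the last. This makes the
  -- exponent exact when the new letter is starred.
  notLast⇒unstarredFrom>0 : ∀ {n} (S : Subset n) p → LastOut S → notLast p ≡ true → 0 ℕ.< unstarredFrom S p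
  notLast⇒unstarredFrom>0 []      zero    _   ()
  notLast⇒unstarredFrom>0 (s ∷ S) zero    out _ = lastOut⇒unstarred>0 (s ∷ S) out
  notLast⇒unstarredFrom>0 (s ∷ S) (suc p) out e = notLast⇒unstarredFrom>0 S p (lastOut-tail s S out) e

  ∣insertAt∣-true : ∀ {n} (S : Subset n) p → ∣ insertAt S p true ∣ ≡ suc ∣ S ∣
  ∣insertAt∣-true S           zero    = refl
  ∣insertAt∣-true (true ∷ S)  (suc p) = cong suc (∣insertAt∣-true S p)
  ∣insertAt∣-true (false ∷ S) (suc p) = ∣insertAt∣-true S p

  ∣insertAt∣-false : ∀ {n} (S : Subset n) p → ∣ insertAt S p false ∣ ≡ ∣ S ∣
  ∣insertAt∣-false S           zero    = refl
  ∣insertAt∣-false (true ∷ S)  (suc p) = cong suc (∣insertAt∣-false S p)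
  ∣insertAt∣-false (false ∷ S) (suc p) = ∣insertAt∣-false S p

  -- Inversions whose right end is unstarred

  ⟦_⟧ : Bool → ℕ
  ⟦ b ⟧ = if b then 1 else 0

  below : ∀ {n} → ℕ → Vec ℕ n → Subset n → ℕ
  below x []      []          = 0
  below x (y ∷ w) (true ∷ S)  = below x w S
  below x (y ∷ w) (false ∷ S) = ⟦ y <ᵇ x ⟧ ℕ.+ below x w S

  -- Grouping by the left end permits recursion on the word; `unstarredInv≡` regroups by the right
  -- end, as `inv□` does.
  unstarredInv : ∀ {n} → Vec ℕ n → Subset n → ℕ
  unstarredInv []      []      = 0
  unstarredInv (x ∷ w) (s ∷ S) = below x w S ℕ.+ unstarredInv w S

  below-max : ∀ {n} (w : Vec ℕ n) S {M} → All (ℕ._< M) w → below M w S ≡ unstarred S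
  below-max []      []          []          = refl
  below-max (y ∷ w) (true ∷ S)  (_ ∷ w<M)   = below-max w S w<M
  below-max (y ∷ w) (false ∷ S) (y<M ∷ w<M) rewrite <⇒<ᵇ≡true y<M = cong suc (below-max w S w<M)

  below-insertAt : ∀ {n} x (w : Vec ℕ n) S p s {M} → x ℕ.< M → below x (insertAt w p M) (insertAt S p s) ≡ below x w S
  below-insertAt x w       S           zero    true  x<M = refl
  below-insertAt x w       S           zero    false x<M rewrite <⇒>ᵇ≡false x<M = refl
  below-insertAt x (y ∷ w) (true ∷ S)  (suc p) s     x<M = below-insertAt x w S p s x<M
  below-insertAt x (y ∷ w) (false ∷ S) (suc p) s     x<M = cong (⟦ y <ᵇ x ⟧ ℕ.+_) (below-insertAt x w S p s x<M)

  -- A largest letter is the right end of no inversion, so its own star does not enter. As a left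
  -- end it is inverted with every letter behind it, of which the unstarred ones count.
  unstarredInv-insertAt : ∀ {n} (w : Vec ℕ n) S p s {M} → All (ℕ._< M) w →
    unstarredInv (insertAt w p M) (insertAt S p s) ≡ unstarredInv w S ℕ.+ unstarredFrom S p
  unstarredInv-insertAt w       S       zero    s w<M =
    trans (cong (ℕ._+ unstarredInv w S) (below-max w S w<M)) (ℕ.+-comm (unstarred S) _)
  unstarredInv-insertAt (x ∷ w) (t ∷ S) (suc p) s (x<M ∷ w<M) = trans
    (cong₂ ℕ._+_ (below-insertAt x w S p s x<M) (unstarredInv-insertAt w S p s w<M))
    (sym (ℕ.+-assoc (below x w S) _ _))

  <ᵇ≡true⇒< : ∀ m n → (m <ᵇ n) ≡ true → m ℕ.< n
  <ᵇ≡true⇒< m n m<n = ℕ.<ᵇ⇒< m n (Equivalence.from T-≡ m<n)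

  -- The letter that ends the run of starred descents is smaller than all letters in it.
  starred-below>0 : ∀ {n} x y (w : Vec ℕ n) S → S ⊑ᵇ descents (y ∷ w) ≡ true → (y <ᵇ x) ≡ true →
                    0 ℕ.< below x (y ∷ w) S
  starred-below>0 x y w       (false ∷ S) S⊑D y<x rewrite y<x = s≤s z≤n
  starred-below>0 x y []      (true ∷ S)  ()  y<x
  starred-below>0 x y (z ∷ w) (true ∷ S)  S⊑D y<x with z <ᵇ y in z<y
  ... | true  = starred-below>0 x z w S S⊑D (<⇒<ᵇ≡true (ℕ.<-trans (<ᵇ≡true⇒< z y z<y) (<ᵇ≡true⇒< y x y<x)))
  starred-below>0 x y (z ∷ w) (true ∷ S)  () y<x | false

  -- Each starred letter is the left end of an inversion with an unstarred right end, namely the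
  -- letter that ends its run of stars. Hence the subtraction of ∣ S ∣ in `inv★≡` is exact.
  ∣∣≤unstarredInv : ∀ {n} (w : Vec ℕ n) S → S ⊑ᵇ descents w ≡ true → ∣ S ∣ ℕ.≤ unstarredInv w S
  ∣∣≤unstarredInv []          []          _   = z≤n
  ∣∣≤unstarredInv (x ∷ [])    (false ∷ []) _  = z≤n
  ∣∣≤unstarredInv (x ∷ [])    (true ∷ []) ()
  ∣∣≤unstarredInv (x ∷ y ∷ w) (false ∷ S) S⊑D = ℕ.m≤n⇒m≤o+n (below x (y ∷ w) S) (∣∣≤unstarredInv (y ∷ w) S S⊑D)
  ∣∣≤unstarredInv (x ∷ y ∷ w) (true ∷ S)  S⊑D with y <ᵇ x in y<x
  ... | true  = ℕ.+-mono-≤ (starred-below>0 x y w S S⊑D y<x) (∣∣≤unstarredInv (y ∷ w) S S⊑D)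
  ∣∣≤unstarredInv (x ∷ y ∷ w) (true ∷ S) () | false

  -- nonDescentWeight D and starredMaj D S sum ∣ D ∩ {i, i + 1, …} ∣ over the i outside D, respectively outside S;
  -- summing it over all i gives the major index.
  nonDescentWeight : ∀ {n} → Subset n → ℕ
  nonDescentWeight []          = 0
  nonDescentWeight (true ∷ D)  = nonDescentWeight D
  nonDescentWeight (false ∷ D) = ∣ D ∣ ℕ.+ nonDescentWeight D

  starredMaj : ∀ {n} → Subset n → Subset n → ℕ
  starredMaj []      []          = 0
  starredMaj (d ∷ D) (true ∷ S)  = starredMaj D S
  starredMaj (d ∷ D) (false ∷ S) = ∣ d ∷ D ∣ ℕ.+ starredMaj D S

  ≡ᵇ≡true⇒≡ : ∀ m n → (m ≡ᵇ n) ≡ true → m ≡ n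
  ≡ᵇ≡true⇒≡ m n e = ℕ.≡ᵇ⇒≡ m n (Equivalence.from T-≡ e)

  -- Enumerating permutations by insertion of the largest letter

  letters< : ∀ {n m} (v : Vec (Fin n) m) → All (ℕ._< n) (map toℕ v)
  letters< []      = []
  letters< (x ∷ v) = Fin.toℕ<n x ∷ letters< v

  lookup-ext : ∀ {a} {A : Set a} {n} {v w : Vec A n} → (∀ i → lookup v i ≡ lookup w i) → v ≡ w
  lookup-ext {v = v} {w} v≗w = trans (sym (tabulate∘lookup v)) (trans (tabulate-cong v≗w) (tabulate∘lookup w))

  lookup-injective⇒unique : ∀ {a} {A : Set a} {n} {v : Vec A n} → (∀ {i j} → lookup v i ≡ lookup v j → i ≡ j) → Unique v
  lookup-injective⇒unique {v = v} inj = subst Unique (tabulate∘lookup v) (tabulate⁺ inj)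

  ∈-allVecs : ∀ {a} {A : Set a} {xs : List A} → (∀ x → x ∈ xs) → ∀ {n} (v : Vec A n) → v ∈ allVecs xs n
  ∈-allVecs ∈xs []      = here refl
  ∈-allVecs ∈xs (x ∷ v) = ∈-cartesianProductWith⁺ _∷_ (∈xs x) (∈-allVecs ∈xs v)

  allVecs-unique : ∀ {a} {A : Set a} {xs : List A} → List!.Unique xs → ∀ n → List!.Unique (allVecs xs n)
  allVecs-unique xs! zero    = [] ∷ []
  allVecs-unique xs! (suc n) = List!.cartesianProductWith⁺ _∷_ ∷-injective xs! (allVecs-unique xs! n)

  permutations : ∀ n → List (Word n)
  permutations n = filter unique? (allVecs (allFin n) n)

  ∈-permutations : ∀ {n} {σ : Word n} → Unique σ → σ ∈ permutations n
  ∈-permutations {σ = σ} σ! = ∈-filter⁺ unique? (∈-allVecs ∈-allFin σ) σ!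

  insertMax : ∀ {n} → Word n → Fin (suc n) → Word (suc n)
  insertMax {n} σ p = insertAt (map inject₁ σ) p (fromℕ n)

  toℕ-insertMax : ∀ {n} (σ : Word n) p → map toℕ (insertMax σ p) ≡ insertAt (map toℕ σ) p n
  toℕ-insertMax {n} σ p = trans (map-insertAt toℕ (fromℕ n) (map inject₁ σ) p)
    (cong₂ (λ w M → insertAt w p M) (trans (sym (map-∘ toℕ inject₁ σ)) (map-cong Fin.toℕ-inject₁ σ)) (Fin.toℕ-fromℕ n))

  insertMax-punchIn : ∀ {n} (σ : Word n) p i → lookup (insertMax σ p) (punchIn p i) ≡ inject₁ (lookup σ i)
  insertMax-punchIn {n} σ p i = trans (insertAt-punchIn (map inject₁ σ) p (fromℕ n) i) (lookup-map i inject₁ σ)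

  insertMax-max : ∀ {n} (σ : Word n) p → lookup (insertMax σ p) p ≡ fromℕ n
  insertMax-max {n} σ p = insertAt-lookup (map inject₁ σ) p (fromℕ n)

  data PunchView {n} (p : Fin (suc n)) : Fin (suc n) → Set where
    at   : PunchView p p
    away : ∀ j → PunchView p (punchIn p j)

  punchView : ∀ {n} (p i : Fin (suc n)) → PunchView p i
  punchView p i with p Fin.≟ i
  ... | yes refl = at
  ... | no  p≢i  = subst (PunchView p) (Fin.punchIn-punchOut p≢i) (away (punchOut p≢i))

  -- The place of insertion can be read off from the largest letter: at two different places
  -- `fromℕ n` would equal some `inject₁`.
  insertMax-injective : ∀ {n} {σ τ : Word n} {p r} → insertMax σ p ≡ insertMax τ r → σ ≡ τ × p ≡ r
  insertMax-injective {n} {σ} {τ} {p} {r} eq with punchView r p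
  ... | at     = lookup-ext (λ i → Fin.inject₁-injective (begin
      inject₁ (lookup σ i)                  ≡⟨ insertMax-punchIn σ p i ⟨
      lookup (insertMax σ p) (punchIn p i)  ≡⟨ cong (λ w → lookup w (punchIn p i)) eq ⟩
      lookup (insertMax τ p) (punchIn p i)  ≡⟨ insertMax-punchIn τ p i ⟩
      inject₁ (lookup τ i)                  ∎)) , refl
    where open ≡-Reasoning
  ... | away j = contradiction (begin
      fromℕ n                                  ≡⟨ insertMax-max σ (punchIn r j) ⟨
      lookup (insertMax σ (punchIn r j)) (punchIn r j)     ≡⟨ cong (λ w → lookup w (punchIn r j)) eq ⟩
      lookup (insertMax τ r) (punchIn r j)     ≡⟨ insertMax-punchIn τ r j ⟩
      inject₁ (lookup τ j)                     ∎) Fin.fromℕ≢inject₁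
    where open ≡-Reasoning

  insertMax-unique : ∀ {n} {σ : Word n} p → Unique σ → Unique (insertMax σ p)
  insertMax-unique {n} {σ} p σ! = lookup-injective⇒unique inj
    where
    inj : ∀ {i j} → lookup (insertMax σ p) i ≡ lookup (insertMax σ p) j → i ≡ j
    inj {i} {j} eq with punchView p i | punchView p j
    ... | at     | at     = refl
    ... | at     | away b = contradiction (trans (sym (insertMax-max σ p)) (trans eq (insertMax-punchIn σ p b))) Fin.fromℕ≢inject₁
    ... | away a | at     = contradiction (trans (sym (insertMax-max σ p)) (trans (sym eq) (insertMax-punchIn σ p a))) Fin.fromℕ≢inject₁
    ... | away a | away b = cong (punchIn p) (lookup-injective σ! a b (Fin.inject₁-injective
      (trans (sym (insertMax-punchIn σ p a)) (trans eq (insertMax-punchIn σ p b)))))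

  -- By the pigeonhole principle the largest letter occurs: otherwise the n+1 distinct letters would
  -- fit into n values. Deleting it gives σ.
  insertMax-surjective : ∀ {n} (w : Word (suc n)) → Unique w → ∃₂ λ σ p → Unique σ × w ≡ insertMax σ p
  insertMax-surjective {n} w w! with Fin.any? (λ p → lookup w p Fin.≟ fromℕ n)
  ... | no  ∄max    = contradiction (Fin.injective⇒≤ lowered-injective) ℕ.1+n≰n
    where
    ≢max : ∀ i → n ≢ toℕ (lookup w i)
    ≢max i eq = ∄max (i , Fin.toℕ-injective (trans (sym eq) (sym (Fin.toℕ-fromℕ n))))
    lowered : Fin (suc n) → Fin n
    lowered i = lower₁ (lookup w i) (≢max i)
    lowered-injective : ∀ {i j} → lowered i ≡ lowered j → i ≡ j
    lowered-injective {i} {j} eq = lookup-injective w! i j (Fin.lower₁-injective eq)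
  ... | yes (p , wp≡max) = σ , p , lookup-injective⇒unique σ-injective , lookup-ext (λ i → w≗ (punchView p i))
    where
    ≢max : ∀ i → n ≢ toℕ (lookup w (punchIn p i))
    ≢max i eq = Fin.punchInᵢ≢i p i (lookup-injective w! _ _ (trans
      (Fin.toℕ-injective (trans (sym eq) (sym (Fin.toℕ-fromℕ n)))) (sym wp≡max)))
    lowered : Fin n → Fin n
    lowered i = lower₁ (lookup w (punchIn p i)) (≢max i)
    σ : Word n
    σ = tabulate lowered
    lookup-σ : ∀ i → inject₁ (lookup σ i) ≡ lookup w (punchIn p i)
    lookup-σ i = trans (cong inject₁ (lookup∘tabulate lowered i)) (Fin.inject₁-lower₁ _ (≢max i))
    σ-injective : ∀ {i j} → lookup σ i ≡ lookup σ j → i ≡ j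
    σ-injective {i} {j} eq = Fin.punchIn-injective p i j (lookup-injective w! _ _
      (trans (sym (lookup-σ i)) (trans (cong inject₁ eq) (lookup-σ j))))
    w≗ : ∀ {i} → PunchView p i → lookup w i ≡ lookup (insertMax σ p) i
    w≗ at       = trans wp≡max (sym (insertMax-max σ p))
    w≗ (away j) = trans (sym (lookup-σ j)) (sym (insertMax-punchIn σ p j))

  -- Both lists are free of repetitions and have the same members, hence they are rearrangements of
  -- each other; the order of enumeration need not be traced.
  permutations-suc : ∀ n → permutations (suc n) ↭ cartesianProductWith insertMax (permutations n) (allFin (suc n))
  permutations-suc n = ∼bag⇒↭ (unique∧set⇒bag
    (permutations-unique (suc n))
    (List!.cartesianProductWith⁺ insertMax insertMax-injective (permutations-unique n) (List!.allFin⁺ (suc n)))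
    (mk⇔ to from′))
    where
    permutations-unique : ∀ n → List!.Unique (permutations n)
    permutations-unique n = List!.filter⁺ unique? (allVecs-unique (List!.allFin⁺ n) n)
    to : ∀ {w} → w ∈ permutations (suc n) → w ∈ cartesianProductWith insertMax (permutations n) (allFin (suc n))
    to {w} w∈ with σ , p , σ! , refl ← insertMax-surjective w (proj₂ (∈-filter⁻ unique? {xs = allVecs (allFin (suc n)) (suc n)} w∈)) =
      ∈-cartesianProductWith⁺ insertMax (∈-permutations σ!) (∈-allFin p)
    from′ : ∀ {w} → w ∈ cartesianProductWith insertMax (permutations n) (allFin (suc n)) → w ∈ permutations (suc n)
    from′ w∈ with σ , p , σ∈ , _ , refl ← ∈-cartesianProductWith⁻ insertMax (permutations n) (allFin (suc n)) w∈ =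
      ∈-permutations (insertMax-unique p (proj₂ (∈-filter⁻ unique? {xs = allVecs (allFin n) n} σ∈)))

  -- The given statistics as sums over unstarred positions

  lookup-descents⇒ : ∀ {n} (w : Vec ℕ n) i → lookup (descents w) i ≡ true →
                     ∃[ j ] (toℕ j ≡ suc (toℕ i) × lookup w j ℕ.< lookup w i)
  lookup-descents⇒ (x ∷ [])    zero    ()
  lookup-descents⇒ (x ∷ y ∷ w) zero    y<x = suc zero , refl , <ᵇ≡true⇒< y x y<x
  lookup-descents⇒ (x ∷ y ∷ w) (suc i) e   with j , j≡ , lt ← lookup-descents⇒ (y ∷ w) i e = suc j , cong suc j≡ , lt

  lookup-descents⇐ : ∀ {n} (w : Vec ℕ n) i j → toℕ j ≡ suc (toℕ i) → lookup w j ℕ.< lookup w i → lookup (descents w) i ≡ true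
  lookup-descents⇐ (x ∷ y ∷ w) zero    (suc zero) refl lt = <⇒<ᵇ≡true lt
  lookup-descents⇐ (x ∷ y ∷ w) (suc i) (suc j)    j≡   lt = lookup-descents⇐ (y ∷ w) i j (ℕ.suc-injective j≡) lt

  Des≡descents : ∀ {n} (σ : Word n) → Des σ ≡ descents (map toℕ σ)
  Des≡descents σ = lookup-ext (λ i → trans (lookup∘tabulate _ i) (does≡ i))
    where
    does≡ : ∀ i → does (isDescent? σ i) ≡ lookup (descents (map toℕ σ)) i
    does≡ i with isDescent? σ i
    ... | yes (j , j≡ , lt) = sym (lookup-descents⇐ (map toℕ σ) i j j≡
      (subst₂ ℕ._<_ (sym (lookup-map j toℕ σ)) (sym (lookup-map i toℕ σ)) lt))
    ... | no  ¬descent with lookup (descents (map toℕ σ)) i in e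
    ...   | false = refl
    ...   | true  with j , j≡ , lt ← lookup-descents⇒ (map toℕ σ) i e =
      contradiction (j , j≡ , subst₂ ℕ._<_ (lookup-map j toℕ σ) (lookup-map i toℕ σ) lt) ¬descent

  does-⊆? : ∀ {n} (S D : Subset n) → does (S ⊆? D) ≡ S ⊑ᵇ D
  does-⊆? []          []          = refl
  does-⊆? (false ∷ S) (d ∷ D)     = does-⊆? S D
  does-⊆? (true ∷ S)  (false ∷ D) = refl
  does-⊆? (true ∷ S)  (true ∷ D)  = does-⊆? S D

  does-∈? : ∀ {n} i (S : Subset n) → does (i ∈? S) ≡ lookup S i
  does-∈? zero    (true ∷ S)  = refl
  does-∈? zero    (false ∷ S) = refl
  does-∈? (suc i) (s ∷ S)     = does-∈? i S

  length-filter : ∀ {a p} {A : Set a} {P : Pred A p} (P? : Decidable P) xs →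
                  length (filter P? xs) ≡ ∑ xs (λ x → ⟦ does (P? x) ⟧)
  length-filter P? []       = refl
  length-filter P? (x ∷ xs) with does (P? x)
  ... | true  = cong suc (length-filter P? xs)
  ... | false = length-filter P? xs

  sum-map : ∀ {a} {A : Set a} (f : A → ℕ) xs → List.sum (List.map f xs) ≡ ∑ xs f
  sum-map f []       = refl
  sum-map f (x ∷ xs) = cong (f x +_) (sum-map f xs)

  sumOver≡ : ∀ {n} (S : Subset n) f → sumOver S f ≡ sum (λ i → ℕΣ.guard (lookup S i) (f i))
  sumOver≡ {n} S f = begin
    sumOver S f                                                      ≡⟨ sum-map f (filter (_∈? S) (allFin n)) ⟩
    ∑ (filter (_∈? S) (allFin n)) f                                  ≡⟨ ℕΣ.∑-filter (_∈? S) (allFin n) f ⟩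
    ∑ (allFin n) (λ i → ℕΣ.guard (does (i ∈? S)) (f i))              ≡⟨ ℕΣ.∑-allFin n _ ⟩
    sum (λ i → ℕΣ.guard (does (i ∈? S)) (f i))                       ≡⟨ ℕΣ.sum-cong n (λ i → ℕΣ.guard-congˡ (f i) (does-∈? i S)) ⟩
    sum (λ i → ℕΣ.guard (lookup S i) (f i))                          ∎
    where open ≡-Reasoning

  sumIn sumOut : ∀ {n} → Subset n → (Fin n → ℕ) → ℕ
  sumIn  S f = sum (λ i → ℕΣ.guard (lookup S i) (f i))
  sumOut S f = sum (λ i → ℕΣ.guard (not (lookup S i)) (f i))

  sum≡sumOut+sumIn : ∀ {n} (S : Subset n) f → sum f ≡ sumOut S f + sumIn S f
  sum≡sumOut+sumIn {n} S f = trans (ℕΣ.sum-cong n (λ i → ℕΣ.guard-split (lookup S i) (f i)))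
    (ℕΣ.sum-+ n (λ i → ℕΣ.guard (not (lookup S i)) (f i)) (λ i → ℕΣ.guard (lookup S i) (f i)))

  sumIn-1 : ∀ {n} (S : Subset n) → sumIn S (λ _ → 1) ≡ ∣ S ∣
  sumIn-1 []          = refl
  sumIn-1 (true ∷ S)  = cong suc (sumIn-1 S)
  sumIn-1 (false ∷ S) = sumIn-1 S

  sumIn-+ : ∀ {n} (S : Subset n) f g → sumIn S (λ i → f i + g i) ≡ sumIn S f + sumIn S g
  sumIn-+ {n} S f g = trans (ℕΣ.sum-cong n (λ i → ℕΣ.guard-+ (lookup S i) (f i) (g i)))
    (ℕΣ.sum-+ n (λ i → ℕΣ.guard (lookup S i) (f i)) (λ i → ℕΣ.guard (lookup S i) (g i)))

  sumOut-+ : ∀ {n} (S : Subset n) f g → sumOut S (λ i → f i + g i) ≡ sumOut S f + sumOut S g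
  sumOut-+ {n} S f g = trans (ℕΣ.sum-cong n (λ i → ℕΣ.guard-+ (not (lookup S i)) (f i) (g i)))
    (ℕΣ.sum-+ n (λ i → ℕΣ.guard (not (lookup S i)) (f i)) (λ i → ℕΣ.guard (not (lookup S i)) (g i)))

  invBit : ∀ {n} → Vec ℕ n → Fin n → Fin n → ℕ
  invBit w i j = ⟦ (toℕ i <ᵇ toℕ j) ∧ (lookup w j <ᵇ lookup w i) ⟧

  invAt : ∀ {n} → Vec ℕ n → Fin n → ℕ
  invAt w j = sum (λ i → invBit w i j)

  does-isInversion? : ∀ {n} (σ : Word n) i j → ⟦ does (isInversion? σ i j) ⟧ ≡ invBit (map toℕ σ) i j
  does-isInversion? σ i j rewrite lookup-map i toℕ σ | lookup-map j toℕ σ = refl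

  inv□≡ : ∀ {n} (σ : Word n) j → inv□ σ j ≡ invAt (map toℕ σ) j
  inv□≡ {n} σ j = begin
    inv□ σ j                                                      ≡⟨ length-filter (λ i → isInversion? σ i j) (allFin n) ⟩
    ∑ (allFin n) (λ i → ⟦ does (isInversion? σ i j) ⟧)             ≡⟨ ℕΣ.∑-allFin n _ ⟩
    sum (λ i → ⟦ does (isInversion? σ i j) ⟧)                      ≡⟨ ℕΣ.sum-cong n (λ i → does-isInversion? σ i j) ⟩
    invAt (map toℕ σ) j                                           ∎
    where open ≡-Reasoning

  inv≡ : ∀ {n} (σ : Word n) → inv σ ≡ sum (invAt (map toℕ σ))
  inv≡ {n} σ = begin
    inv σ
      ≡⟨ length-filter (λ (i , j) → isInversion? σ i j) (List.cartesianProduct (allFin n) (allFin n)) ⟩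
    ∑ (List.cartesianProduct (allFin n) (allFin n)) (λ (i , j) → ⟦ does (isInversion? σ i j) ⟧)
      ≡⟨ ℕΣ.∑-square n _ ⟩
    sum (λ i → sum (λ j → ⟦ does (isInversion? σ i j) ⟧))
      ≡⟨ ℕΣ.sum-cong n (λ i → ℕΣ.sum-cong n (λ j → does-isInversion? σ i j)) ⟩
    sum (λ i → sum (λ j → invBit (map toℕ σ) i j))
      ≡⟨ ∑-comm {n} {n} (invBit (map toℕ σ)) ⟩
    sum (invAt (map toℕ σ)) ∎
    where open ≡-Reasoning

  below≡ : ∀ {n} x (w : Vec ℕ n) S → below x w S ≡ sumOut S (λ j → ⟦ lookup w j <ᵇ x ⟧)
  below≡ x []      []          = refl
  below≡ x (y ∷ w) (true ∷ S)  = below≡ x w S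
  below≡ x (y ∷ w) (false ∷ S) = cong (⟦ y <ᵇ x ⟧ +_) (below≡ x w S)

  -- Grouped by right ends, the requirement that j be unstarred merely restricts the outer sum. The
  -- head contributes nothing there, since no letter precedes it.
  unstarredInv≡ : ∀ {n} (w : Vec ℕ n) S → unstarredInv w S ≡ sumOut S (invAt w)
  unstarredInv≡ []          []      = refl
  unstarredInv≡ {suc n} (x ∷ w) (s ∷ S) = begin
    below x w S + unstarredInv w S                                      ≡⟨ cong₂ _+_ (below≡ x w S) (unstarredInv≡ w S) ⟩
    sumOut S (λ j → ⟦ lookup w j <ᵇ x ⟧) + sumOut S (invAt w)           ≡⟨ sumOut-+ S (λ j → ⟦ lookup w j <ᵇ x ⟧) (invAt w) ⟨
    sumOut S (λ j → ⟦ lookup w j <ᵇ x ⟧ + invAt w j)                    ≡⟨ cong (_+ sumOut S (λ j → ⟦ lookup w j <ᵇ x ⟧ + invAt w j)) first ⟨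
    ℕΣ.guard (not s) (invAt (x ∷ w) zero) + sumOut S (λ j → ⟦ lookup w j <ᵇ x ⟧ + invAt w j) ∎
    where
    open ≡-Reasoning
    first : ℕΣ.guard (not s) (invAt (x ∷ w) zero) ≡ 0
    first = trans (cong (ℕΣ.guard (not s)) (ℕΣ.sum-zero (suc n) {λ i → invBit (x ∷ w) i zero} (λ i → refl))) (ℕΣ.guard-0 (not s))

  -- When `inv σ` is split by right ends, its part over S is exactly the sum of the `inv□ σ i` that
  -- is subtracted. After cancellation one unit per star remains.
  inv★≡ : ∀ {n} (σ : Word n) S → inv★ (σ , S) ≡ unstarredInv (map toℕ σ) S ∸ ∣ S ∣
  inv★≡ {n} σ S = begin
    inv σ ∸ sumOver S (λ i → 1 + inv□ σ i)              ≡⟨ cong₂ _∸_ (trans (inv≡ σ) (sum≡sumOut+sumIn S (invAt w))) starred ⟩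
    (sumOut S (invAt w) + I) ∸ (∣ S ∣ + I)              ≡⟨ cong₂ _∸_ (ℕ.+-comm (sumOut S (invAt w)) I) (ℕ.+-comm ∣ S ∣ I) ⟩
    (I + sumOut S (invAt w)) ∸ (I + ∣ S ∣)              ≡⟨ ℕ.[m+n]∸[m+o]≡n∸o I (sumOut S (invAt w)) ∣ S ∣ ⟩
    sumOut S (invAt w) ∸ ∣ S ∣                          ≡⟨ cong (_∸ ∣ S ∣) (unstarredInv≡ w S) ⟨
    unstarredInv w S ∸ ∣ S ∣                            ∎
    where
    open ≡-Reasoning
    w = map toℕ σ
    I = sumIn S (invAt w)
    starred : sumOver S (λ i → 1 + inv□ σ i) ≡ ∣ S ∣ + I
    starred = begin
      sumOver S (λ i → 1 + inv□ σ i)      ≡⟨ sumOver≡ S _ ⟩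
      sumIn S (λ i → 1 + inv□ σ i)        ≡⟨ ℕΣ.sum-cong n (λ i → cong (λ m → ℕΣ.guard (lookup S i) (1 + m)) (inv□≡ σ i)) ⟩
      sumIn S (λ i → 1 + invAt w i)       ≡⟨ sumIn-+ S (λ _ → 1) (invAt w) ⟩
      sumIn S (λ _ → 1) + I               ≡⟨ cong (_+ I) (sumIn-1 S) ⟩
      ∣ S ∣ + I                           ∎

  countFrom : ∀ {n} → Subset n → Fin n → ℕ
  countFrom (d ∷ D) zero    = ∣ d ∷ D ∣
  countFrom (d ∷ D) (suc i) = countFrom D i

  ∣∩from∣ : ∀ {n} (D : Subset n) i → ∣ D ∩ from i ∣ ≡ countFrom D i
  ∣∩from∣ (d ∷ D) zero    = cong ∣_∣ (∩-all (d ∷ D))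
    where
    ∩-all : ∀ {n} (D : Subset n) → D ∩ tabulate (λ _ → true) ≡ D
    ∩-all []          = refl
    ∩-all (true ∷ D)  = cong (true ∷_) (∩-all D)
    ∩-all (false ∷ D) = cong (false ∷_) (∩-all D)
  ∣∩from∣ (d ∷ D) (suc i) = trans (drop d) (trans (cong (λ F → ∣ D ∩ F ∣) (lookup-ext shift)) (∣∩from∣ D i))
    where
    drop : ∀ d → ∣ (d ∷ D) ∩ from (suc i) ∣ ≡ ∣ D ∩ tabulate (λ j → toℕ i <ᵇ suc (toℕ j)) ∣
    drop true  = refl
    drop false = refl
    <ᵇ-suc : ∀ m n → (m <ᵇ suc n) ≡ (m ≤ᵇ n)
    <ᵇ-suc zero    n = refl
    <ᵇ-suc (suc m) n = refl
    shift : ∀ j → lookup (tabulate (λ j → toℕ i <ᵇ suc (toℕ j))) j ≡ lookup (from i) j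
    shift j = trans (lookup∘tabulate _ j) (trans (<ᵇ-suc (toℕ i) (toℕ j)) (sym (lookup∘tabulate _ j)))

  -- Double counting of the pairs i ≤ d with d in D: a given d occurs with `position d` values of i.
  sumIn-position : ∀ {n} (D : Subset n) → sumIn D position ≡ sum (countFrom D)
  sumIn-position []      = refl
  sumIn-position {suc n} (d ∷ D) = begin
    ℕΣ.guard d 1 + sumIn D (λ i → 1 + position i)              ≡⟨ cong (ℕΣ.guard d 1 +_) (sumIn-+ D (λ _ → 1) position) ⟩
    ℕΣ.guard d 1 + (sumIn D (λ _ → 1) + sumIn D position)      ≡⟨ ℕ.+-assoc (ℕΣ.guard d 1) _ _ ⟨
    ℕΣ.guard d 1 + sumIn D (λ _ → 1) + sumIn D position        ≡⟨ cong₂ _+_ (sumIn-1 (d ∷ D)) (sumIn-position D) ⟩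
    ∣ d ∷ D ∣ + sum (countFrom D)                              ∎
    where open ≡-Reasoning

  starredMaj≡ : ∀ {n} (D S : Subset n) → starredMaj D S ≡ sumOut S (countFrom D)
  starredMaj≡ []      []          = refl
  starredMaj≡ (d ∷ D) (true ∷ S)  = starredMaj≡ D S
  starredMaj≡ (d ∷ D) (false ∷ S) = cong (∣ d ∷ D ∣ +_) (starredMaj≡ D S)

  -- With `maj σ` written as the sum of all ∣ D ∩ from i ∣, the subtracted sum is its part over S,
  -- and the part outside S is left.
  maj★≡ : ∀ {n} (σ : Word n) S → maj★ (σ , S) ≡ starredMaj (Des σ) S
  maj★≡ {n} σ S = begin
    maj σ ∸ sumOver S (λ i → ∣ D ∩ from i ∣)
      ≡⟨ cong₂ _∸_ (trans (sumOver≡ D position) (sumIn-position D))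
           (trans (sumOver≡ S _) (ℕΣ.sum-cong n (λ i → cong (ℕΣ.guard (lookup S i)) (∣∩from∣ D i)))) ⟩
    sum (countFrom D) ∸ sumIn S (countFrom D)
      ≡⟨ cong (_∸ sumIn S (countFrom D)) (sum≡sumOut+sumIn S (countFrom D)) ⟩
    (sumOut S (countFrom D) + sumIn S (countFrom D)) ∸ sumIn S (countFrom D)
      ≡⟨ ℕ.m+n∸n≡m _ (sumIn S (countFrom D)) ⟩
    sumOut S (countFrom D)
      ≡⟨ starredMaj≡ D S ⟨
    starredMaj D S ∎
    where
    open ≡-Reasoning
    D = Des σ

-- Mixed placements read column by column

module RookPlacements where

  open ≡ using (_≡_; _≢_; refl; sym; trans; cong; cong₂; subst; subst₂; module ≡-Reasoning)
  open import Data.Nat.Base using (_+_)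
  open import Algebra.Properties.Semiring.Sum ℕ.+-*-semiring using (sum)
  open QAnalogue ℕ.+-*-commutativeSemiring 0 using (∑)
  open StarredPermutations

  ∧≡true⁺ : ∀ {a b} → a ≡ true → b ≡ true → a ∧ b ≡ true
  ∧≡true⁺ refl refl = refl

  ∧≡true⁻ : ∀ a {b} → a ∧ b ≡ true → a ≡ true × b ≡ true
  ∧≡true⁻ true b≡true = refl , b≡true

  does-≡ᵇ : ∀ {p} {P : Set p} (P? : Dec P) {b} → (P → b ≡ true) → (b ≡ true → P) → does P? ≡ b
  does-≡ᵇ (yes p)        sound complete = sym (sound p)
  does-≡ᵇ (no ¬p) {true}  sound complete = contradiction (complete refl) ¬p
  does-≡ᵇ (no ¬p) {false} sound complete = refl

  Rows : ℕ → Set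
  Rows N = Fin N → Bool

  cells : ∀ N → List (Kind × Fin N)
  cells N = cartesianProduct (nonAttacking ∷ file ∷ []) (allFin N)

  -- The bottom cell of its column is both forbidden to a non-attacking rook and cancelled by it, so
  -- one predicate serves the validity of a placement and the count of uncancelled cells.
  allowed : ∀ {N} → Kind → Rows N
  allowed nonAttacking r = 0 <ᵇ toℕ r
  allowed file         r = true

  -- A file rook cancels within its own column only; the state passed on to later columns changes by
  -- the row of a non-attacking rook.
  place : ∀ {N} → Kind → Fin N → Rows N → Rows N
  place nonAttacking r A x = A x ∧ not (does (r Fin.≟ x))
  place file         r A x = A x

  -- The next column is column m; A is the set of rows not cancelled by a non-attacking rook to its left.
  valid : ∀ {N r} → ℕ → Rows N → Vec (Kind × Fin N) r → Bool
  valid m A []            = true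
  valid m A ((t , r) ∷ v) = ((toℕ r <ᵇ suc m) ∧ (A r ∧ allowed t r)) ∧ valid (suc m) (place t r A) v

  rank : ∀ {N} → Rows N → Fin N → ℕ
  rank B r = sum (λ x → ⟦ (toℕ x <ᵇ toℕ r) ∧ B x ⟧)

  -- A rook cancels its column from its own cell upward, so the uncancelled cells are those below it
  -- in rows that are open and allowed for its kind.
  uncFrom : ∀ {N r} → Rows N → Vec (Kind × Fin N) r → ℕ
  uncFrom A []            = 0
  uncFrom A ((t , r) ∷ v) = rank (λ x → A x ∧ allowed t x) r + uncFrom (place t r A) v

  #N : ∀ {N r} → Vec (Kind × Fin N) r → ℕ
  #N []                       = 0
  #N ((nonAttacking , _) ∷ v) = suc (#N v)
  #N ((file         , _) ∷ v) = #N v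

  -- The state in which the recursion reaches column c. It translates the recursive definitions into
  -- conditions on single columns, the form in which `IsMixed` is given.
  rowsBefore : ∀ {N r} → Rows N → Vec (Kind × Fin N) r → Fin r → Rows N
  rowsBefore A (e ∷ v)       zero    = A
  rowsBefore A ((t , r) ∷ v) (suc c) = rowsBefore (place t r A) v c

  module _ {N : ℕ} where

    private
      kindAt : ∀ {r} → Vec (Kind × Fin N) r → Fin r → Kind
      kindAt v c = proj₁ (lookup v c)
      rowAt : ∀ {r} → Vec (Kind × Fin N) r → Fin r → Fin N
      rowAt v c = proj₂ (lookup v c)

    place⁻ : ∀ t r (A : Rows N) x → place t r A x ≡ true → A x ≡ true × (t ≡ nonAttacking → r ≢ x)
    place⁻ file         r A x e = e , λ ()
    place⁻ nonAttacking r A x e with ∧≡true⁻ (A x) e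
    ... | Ax , r≠x with r Fin.≟ x
    ...   | no r≢x = Ax , λ _ → r≢x
    place⁻ nonAttacking r A x e | Ax , () | yes _

    place⁺ : ∀ t r (A : Rows N) x → A x ≡ true → (t ≡ nonAttacking → r ≢ x) → place t r A x ≡ true
    place⁺ file         r A x Ax r≢x = Ax
    place⁺ nonAttacking r A x Ax r≢x with r Fin.≟ x
    ... | yes r≡x = contradiction r≡x (r≢x refl)
    ... | no  _   = ∧≡true⁺ Ax refl

    rowsBefore⁻ : ∀ {r} (A : Rows N) (v : Vec _ r) c x → rowsBefore A v c x ≡ true →
      A x ≡ true × (∀ c′ → toℕ c′ ℕ.< toℕ c → kindAt v c′ ≡ nonAttacking → rowAt v c′ ≢ x)
    rowsBefore⁻ A (_ ∷ v)       zero    x e = e , λ _ ()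
    rowsBefore⁻ A ((t , r) ∷ v) (suc c) x e
      with free , later ← rowsBefore⁻ (place t r A) v c x e
      with Ax , r≢x ← place⁻ t r A x free
      = Ax , λ { zero _ → r≢x ; (suc c′) (s≤s c′<c) → later c′ c′<c }

    rowsBefore⁺ : ∀ {r} (A : Rows N) (v : Vec _ r) c x → A x ≡ true →
      (∀ c′ → toℕ c′ ℕ.< toℕ c → kindAt v c′ ≡ nonAttacking → rowAt v c′ ≢ x) → rowsBefore A v c x ≡ true
    rowsBefore⁺ A (_ ∷ v)       zero    x Ax free = Ax
    rowsBefore⁺ A ((t , r) ∷ v) (suc c) x Ax free = rowsBefore⁺ (place t r A) v c x
      (place⁺ t r A x Ax (free zero (s≤s z≤n))) (λ c′ c′<c → free (suc c′) (s≤s c′<c))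

    ValidAt : ∀ {r} → ℕ → Rows N → Vec (Kind × Fin N) r → Fin r → Set
    ValidAt m A v c = toℕ (rowAt v c) ℕ.≤ m + toℕ c × rowsBefore A v c (rowAt v c) ≡ true × allowed (kindAt v c) (rowAt v c) ≡ true

    valid⁻ : ∀ {r} m (A : Rows N) (v : Vec _ r) → valid m A v ≡ true → ∀ c → ValidAt m A v c
    valid⁻ m A ((t , r) ∷ v) e zero
      with e₁ , _ ← ∧≡true⁻ ((toℕ r <ᵇ suc m) ∧ (A r ∧ allowed t r)) e
      with r≤m , e₂ ← ∧≡true⁻ (toℕ r <ᵇ suc m) e₁
      with Ar , ok ← ∧≡true⁻ (A r) e₂
      = ℕ.≤-trans (ℕ.≤-pred (<ᵇ≡true⇒< (toℕ r) (suc m) r≤m)) (ℕ.m≤m+n m 0) , Ar , ok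
    valid⁻ m A ((t , r) ∷ v) e (suc c)
      with _ , e₁ ← ∧≡true⁻ ((toℕ r <ᵇ suc m) ∧ (A r ∧ allowed t r)) e
      with r≤m , rest ← valid⁻ (suc m) (place t r A) v e₁ c
      = ℕ.≤-trans r≤m (ℕ.≤-reflexive (sym (ℕ.+-suc m (toℕ c)))) , rest

    valid⁺ : ∀ {r} m (A : Rows N) (v : Vec _ r) → (∀ c → ValidAt m A v c) → valid m A v ≡ true
    valid⁺ m A []            ok = refl
    valid⁺ m A ((t , r) ∷ v) ok with r≤m , Ar , okr ← ok zero = ∧≡true⁺
      (∧≡true⁺ (<⇒<ᵇ≡true (s≤s (ℕ.≤-trans r≤m (ℕ.≤-reflexive (ℕ.+-identityʳ m))))) (∧≡true⁺ Ar okr))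
      (valid⁺ (suc m) (place t r A) v (λ c → let (r≤m , rest) = ok (suc c) in
        ℕ.≤-trans r≤m (ℕ.≤-reflexive (ℕ.+-suc m (toℕ c))) , rest))

    uncFrom≡ : ∀ {r} (A : Rows N) (v : Vec _ r) → uncFrom A v ≡
      sum (λ c → rank (λ x → rowsBefore A v c x ∧ allowed (kindAt v c) x) (rowAt v c))
    uncFrom≡ A []            = refl
    uncFrom≡ A ((t , r) ∷ v) = cong (rank (λ x → A x ∧ allowed t x) r +_) (uncFrom≡ (place t r A) v)

  ∣nonAttacking∣ : ∀ {N r} (v : Vec (Kind × Fin N) r) → ∣ comprehension (λ c → proj₁ (lookup v c) ≟ᴷ nonAttacking) ∣ ≡ #N v
  ∣nonAttacking∣ []                       = refl
  ∣nonAttacking∣ ((nonAttacking , _) ∷ v) = cong suc (∣nonAttacking∣ v)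
  ∣nonAttacking∣ ((file         , _) ∷ v) = ∣nonAttacking∣ v

  ∣file∣ : ∀ {N r} (v : Vec (Kind × Fin N) r) → ∣ comprehension (λ c → proj₁ (lookup v c) ≟ᴷ file) ∣ + #N v ≡ r
  ∣file∣ []                       = refl
  ∣file∣ ((nonAttacking , _) ∷ v) = trans (ℕ.+-suc _ (#N v)) (cong suc (∣file∣ v))
  ∣file∣ ((file         , _) ∷ v) = cong suc (∣file∣ v)

  module _ {N : ℕ} where

    cancels-other⁻ : ∀ t {c r c′ r′ : Fin N} → c′ ≢ c → Cancels t (c , r) (c′ , r′) →
                     t ≡ nonAttacking × r′ ≡ r × toℕ c ℕ.< toℕ c′
    cancels-other⁻ nonAttacking c′≢c (inj₁ (c′≡c , _))                = contradiction c′≡c c′≢c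
    cancels-other⁻ nonAttacking c′≢c (inj₂ (inj₁ (r′≡r , c<c′)))      = refl , r′≡r , c<c′
    cancels-other⁻ nonAttacking c′≢c (inj₂ (inj₂ (c′≡c , _)))         = contradiction c′≡c c′≢c
    cancels-other⁻ file         c′≢c (inj₁ (c′≡c , _))                = contradiction c′≡c c′≢c
    cancels-other⁻ file         c′≢c (inj₂ (c′≡c , _))                = contradiction c′≡c c′≢c

    cancels-other⁺ : ∀ t {c r c′ r′ : Fin N} → t ≡ nonAttacking → r ≡ r′ → toℕ c ℕ.< toℕ c′ → Cancels t (c , r) (c′ , r′)
    cancels-other⁺ nonAttacking _ r≡r′ c<c′ = inj₂ (inj₁ (sym r≡r′ , c<c′))

    cancels-own⁺ : ∀ t {c r x : Fin N} → toℕ r ℕ.≤ toℕ x ⊎ allowed t x ≡ false → Cancels t (c , r) (c , x)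
    cancels-own⁺ t {c} {r} {x} (inj₁ r≤x) with ℕ.m≤n⇒m<n∨m≡n r≤x
    cancels-own⁺ nonAttacking  (inj₁ _) | inj₁ r<x = inj₂ (inj₂ (refl , inj₁ r<x))
    cancels-own⁺ file          (inj₁ _) | inj₁ r<x = inj₂ (refl , r<x)
    cancels-own⁺ nonAttacking  (inj₁ _) | inj₂ r≡x = inj₁ (refl , sym (Fin.toℕ-injective r≡x))
    cancels-own⁺ file          (inj₁ _) | inj₂ r≡x = inj₁ (refl , sym (Fin.toℕ-injective r≡x))
    cancels-own⁺ nonAttacking {x = zero} (inj₂ _)  = inj₂ (inj₂ (refl , inj₂ refl))
    cancels-own⁺ nonAttacking {x = suc x} (inj₂ ())

    cancels-own⁻ : ∀ t {c r x : Fin N} → Cancels t (c , r) (c , x) → toℕ r ℕ.≤ toℕ x ⊎ allowed t x ≡ false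
    cancels-own⁻ nonAttacking (inj₁ (_ , refl))              = inj₁ ℕ.≤-refl
    cancels-own⁻ nonAttacking (inj₂ (inj₁ (_ , c<c)))        = contradiction c<c (ℕ.<-irrefl refl)
    cancels-own⁻ nonAttacking (inj₂ (inj₂ (_ , inj₁ r<x)))   = inj₁ (ℕ.<⇒≤ r<x)
    cancels-own⁻ nonAttacking {x = zero}  (inj₂ (inj₂ (_ , inj₂ _)))  = inj₂ refl
    cancels-own⁻ nonAttacking {x = suc _} (inj₂ (inj₂ (_ , inj₂ ())))
    cancels-own⁻ file         (inj₁ (_ , refl))              = inj₁ ℕ.≤-refl
    cancels-own⁻ file         (inj₂ (_ , r<x))               = inj₁ (ℕ.<⇒≤ r<x)

    allRows : Rows N
    allRows _ = true

    isMixed⇒valid : ∀ {k} {P : Placement N} → IsMixed k P → valid 0 allRows P ∧ (#N P ≡ᵇ k) ≡ true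
    isMixed⇒valid {k} {P} mixed = ∧≡true⁺ (valid⁺ 0 allRows P validAt) (≡⇒≡ᵇ≡true (trans (sym (∣nonAttacking∣ P)) #nonAttacking))
      where
      open IsMixed mixed
      ≡⇒≡ᵇ≡true : ∀ {m n} → m ≡ n → (m ≡ᵇ n) ≡ true
      ≡⇒≡ᵇ≡true {zero}  refl = refl
      ≡⇒≡ᵇ≡true {suc m} refl = ≡⇒≡ᵇ≡true {m} refl
      allowed′ : ∀ t r → (t ≡ nonAttacking → ¬ FirstRow r) → allowed {N} t r ≡ true
      allowed′ file         r       _   = refl
      allowed′ nonAttacking zero    ¬fr = contradiction refl (¬fr refl)
      allowed′ nonAttacking (suc r) _   = refl
      validAt : ∀ c → ValidAt 0 allRows P c
      validAt c = onBoard c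
        , rowsBefore⁺ allRows P c (row P c) refl (λ c′ c′<c N r≡ →
            notCancelled c′ c (λ { refl → ℕ.<-irrefl refl c′<c }) (cancels-other⁺ (kind P c′) N r≡ c′<c))
        , allowed′ (kind P c) (row P c) (notFirstRow c)

    valid⇒isMixed : ∀ {k} {P : Placement N} → valid 0 allRows P ∧ (#N P ≡ᵇ k) ≡ true → IsMixed k P
    valid⇒isMixed {k} {P} e = isMixed
      (λ c → proj₁ (ok c))
      (trans (∣nonAttacking∣ P) #N≡k)
      -- Every column holds a rook of one of the two kinds, so the file rooks fill the remaining
      -- columns.
      (trans (sym (ℕ.m+n∸n≡m _ (#N P))) (cong₂ _∸_ (∣file∣ P) #N≡k))
      (λ c → firstRow (kind P c) (row P c) (proj₂ (proj₂ (ok c))))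
      (λ c c′ c≢c′ cancelled → let (N , r≡ , c<c′) = cancels-other⁻ (kind P c) (c≢c′ ∘ sym) cancelled in
        proj₂ (rowsBefore⁻ allRows P c′ (row P c′) (proj₁ (proj₂ (ok c′)))) c c<c′ N (sym r≡))
      where
      ok : ∀ c → ValidAt 0 allRows P c
      ok = valid⁻ 0 allRows P (proj₁ (∧≡true⁻ (valid 0 allRows P) e))
      #N≡k : #N P ≡ k
      #N≡k = ≡ᵇ≡true⇒≡ (#N P) k (proj₂ (∧≡true⁻ (valid 0 allRows P) e))
      firstRow : ∀ t r → allowed {N} t r ≡ true → t ≡ nonAttacking → ¬ FirstRow r
      firstRow nonAttacking zero    () _
      firstRow nonAttacking (suc r) _  _ ()

    does-isMixed? : ∀ k (P : Placement N) → does (isMixed? k P) ≡ valid 0 allRows P ∧ (#N P ≡ᵇ k)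
    does-isMixed? k P = does-≡ᵇ (isMixed? k P) isMixed⇒valid valid⇒isMixed

    -- Validity puts the rook of each column on the board, and with it all cells below; these are
    -- the only cells of the column that can be uncancelled.
    unc≡uncFrom : ∀ (P : Placement N) → valid 0 allRows P ≡ true → unc P ≡ uncFrom allRows P
    unc≡uncFrom P v = begin
      unc P
        ≡⟨ length-filter (λ x → uncancelled? x) (cartesianProduct (allFin N) (allFin N)) ⟩
      ∑ (cartesianProduct (allFin N) (allFin N)) (λ x → ⟦ does (uncancelled? x) ⟧)
        ≡⟨ ℕΣ.∑-square N _ ⟩
      sum (λ c → sum (λ x → ⟦ does (uncancelled? (c , x)) ⟧))
        ≡⟨ ℕΣ.sum-cong N (λ c → ℕΣ.sum-cong N (λ x → cong ⟦_⟧ (does-≡ᵇ (uncancelled? (c , x)) (to c x) (from′ c x)))) ⟩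
      sum (λ c → rank (λ x → rowsBefore allRows P c x ∧ allowed (kind P c) x) (row P c))
        ≡⟨ uncFrom≡ allRows P ⟨
      uncFrom allRows P ∎
      where
      open ≡-Reasoning
      Uncancelled : Cell N → Set
      Uncancelled x = OnBoard x × ¬ (∃[ c ] CancelledBy P c x)
      uncancelled? : ∀ x → Dec (Uncancelled x)
      uncancelled? x = onBoard? x ×-dec ¬? (Fin.any? (λ c → cancelledBy? P c x))
      bit : Fin N → Fin N → Bool
      bit c x = (toℕ x <ᵇ toℕ (row P c)) ∧ (rowsBefore allRows P c x ∧ allowed (kind P c) x)
      ≢false⇒≡true : ∀ {b} → b ≢ false → b ≡ true
      ≢false⇒≡true {true}  _   = refl
      ≢false⇒≡true {false} b≢f = contradiction refl b≢f
      to : ∀ c x → Uncancelled (c , x) → bit c x ≡ true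
      to c x (_ , ¬cancelled) = ∧≡true⁺
        (<⇒<ᵇ≡true (ℕ.≰⇒> (λ r≤x → ¬cancelled (c , cancels-own⁺ (kind P c) (inj₁ r≤x)))))
        (∧≡true⁺
          (rowsBefore⁺ allRows P c x refl (λ c′ c′<c N r≡ → ¬cancelled (c′ , cancels-other⁺ (kind P c′) N r≡ c′<c)))
          (≢false⇒≡true (λ e → ¬cancelled (c , cancels-own⁺ (kind P c) (inj₂ e)))))
      from′ : ∀ c x → bit c x ≡ true → Uncancelled (c , x)
      from′ c x e
        with x<ᵇr , e₁ ← ∧≡true⁻ (toℕ x <ᵇ toℕ (row P c)) e
        with free , ok ← ∧≡true⁻ (rowsBefore allRows P c x) e₁
        = ℕ.≤-trans (ℕ.<⇒≤ x<r) (proj₁ (valid⁻ 0 allRows P v c)) , ¬cancelled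
        where
        x<r : toℕ x ℕ.< toℕ (row P c)
        x<r = <ᵇ≡true⇒< (toℕ x) (toℕ (row P c)) x<ᵇr
        ¬cancelled : ¬ (∃[ c′ ] CancelledBy P c′ (c , x))
        ¬cancelled (c′ , cancelled) with c Fin.≟ c′
        ... | no c≢c′ = let (N , x≡ , c′<c) = cancels-other⁻ (kind P c′) c≢c′ cancelled in
          proj₂ (rowsBefore⁻ allRows P c x free) c′ c′<c N (sym x≡)
        ... | yes refl with cancels-own⁻ (kind P c) cancelled
        ...   | inj₁ r≤x  = ℕ.<⇒≱ x<r r≤x
        ...   | inj₂ ¬ok  = contradiction (trans (sym ok) ¬ok) λ ()

  -- Counting open rows

  size : ∀ {N} → Rows N → ℕ
  size B = sum (λ x → ⟦ B x ⟧)

  size-cong : ∀ {N} {A B : Rows N} → (∀ x → A x ≡ B x) → size A ≡ size B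
  size-cong {N} A≗B = ℕΣ.sum-cong N (λ x → cong ⟦_⟧ (A≗B x))

  size-singleton : ∀ {N} (r : Fin N) → size (λ x → does (r Fin.≟ x)) ≡ 1
  size-singleton {suc N} zero    = cong suc (ℕΣ.sum-zero N {λ _ → 0} (λ _ → refl))
  size-singleton {suc N} (suc r) = size-singleton r

  -- The numerical form of the hypothesis says at once that r lies outside A and that B adds just r.
  size-insert : ∀ {N} (A B : Rows N) (r : Fin N) → (∀ x → ⟦ B x ⟧ ≡ ⟦ A x ⟧ ℕ.+ ⟦ does (r Fin.≟ x) ⟧) → size B ≡ suc (size A)
  size-insert {N} A B r B≗ = begin
    size B                                                     ≡⟨ ℕΣ.sum-cong N B≗ ⟩
    sum (λ x → ⟦ A x ⟧ ℕ.+ ⟦ does (r Fin.≟ x) ⟧)          ≡⟨ ℕΣ.sum-+ N (λ x → ⟦ A x ⟧) (λ x → ⟦ does (r Fin.≟ x) ⟧) ⟩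
    size A ℕ.+ size (λ x → does (r Fin.≟ x))                   ≡⟨ cong (size A ℕ.+_) (size-singleton r) ⟩
    size A ℕ.+ 1                                               ≡⟨ ℕ.+-comm (size A) 1 ⟩
    suc (size A)                                               ∎
    where open ≡-Reasoning

  upTo[_] : ∀ {N} → ℕ → Rows N → Rows N
  upTo[ m ] A x = (toℕ x <ᵇ m) ∧ A x

  size-upTo-suc : ∀ {N} m (A : Rows N) → m ℕ.< N → (∀ x → m ℕ.≤ toℕ x → A x ≡ true) →
                  size (upTo[ suc m ] A) ≡ suc (size (upTo[ m ] A))
  size-upTo-suc m A m<N free = size-insert (upTo[ m ] A) (upTo[ suc m ] A) (fromℕ< m<N) bit
    where
    bit : ∀ x → ⟦ upTo[ suc m ] A x ⟧ ≡ ⟦ upTo[ m ] A x ⟧ ℕ.+ ⟦ does (fromℕ< m<N Fin.≟ x) ⟧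
    bit x with fromℕ< m<N Fin.≟ x
    ... | yes refl rewrite Fin.toℕ-fromℕ< m<N | <⇒<ᵇ≡true (ℕ.n<1+n m)
                           | free (fromℕ< m<N) (ℕ.≤-reflexive (sym (Fin.toℕ-fromℕ< m<N))) = sym (cong (λ b → ⟦ b ∧ true ⟧ ℕ.+ 1) (irrefl m))
      where
      irrefl : ∀ m → (m <ᵇ m) ≡ false
      irrefl zero    = refl
      irrefl (suc m) = irrefl m
    ... | no m≢x rewrite ℕ.+-identityʳ ⟦ upTo[ m ] A x ⟧ = cong (λ b → ⟦ b ∧ A x ⟧) (step (toℕ x) m (λ x≡m →
        m≢x (Fin.toℕ-injective (trans (Fin.toℕ-fromℕ< m<N) (sym x≡m)))))
      where
      step : ∀ x m → x ≢ m → (x <ᵇ suc m) ≡ (x <ᵇ m)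
      step zero    zero    x≢m = contradiction refl x≢m
      step zero    (suc m) x≢m = refl
      step (suc x) zero    x≢m = refl
      step (suc x) (suc m) x≢m = step x m (x≢m ∘ cong suc)

  size-upTo-place : ∀ {N} m (A : Rows N) r → upTo[ m ] A r ≡ true →
                    size (upTo[ m ] A) ≡ suc (size (upTo[ m ] (place nonAttacking r A)))
  size-upTo-place m A r r∈A = size-insert (upTo[ m ] (place nonAttacking r A)) (upTo[ m ] A) r bit
    where
    bit : ∀ x → ⟦ upTo[ m ] A x ⟧ ≡ ⟦ upTo[ m ] (place nonAttacking r A) x ⟧ ℕ.+ ⟦ does (r Fin.≟ x) ⟧
    bit x with r Fin.≟ x
    ... | yes refl rewrite r∈A | ∧-zeroʳ (A r) | ∧-zeroʳ (toℕ r <ᵇ m) = refl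
    ... | no  _      rewrite ∧-identityʳ (A x) = sym (ℕ.+-identityʳ _)

module GeneratingFunctions {c ℓ} (R : CommutativeSemiring c ℓ) (q : CommutativeSemiring.Carrier R) where

  open CommutativeSemiring R hiding (zero)
  open QAnalogue R q
  open Sums R q
  open StarredPermutations
  open RookPlacements
  open import Algebra.Properties.Semiring.Exp semiring using (_^_; ^-homo-*)
  open import Algebra.Properties.Semiring.Sum semiring using (sum)
  open import Algebra.Solver.Ring.NaturalCoefficients.Default R using (solve; _:=_; _:+_; _:*_; con)
  open import Relation.Binary.Reasoning.Setoid setoid

  -- Elementary symmetric polynomials in the powers of q

  prev : (ℕ → Carrier) → ℕ → Carrier
  prev f zero    = 0#
  prev f (suc k) = f k

  -- The elementary symmetric polynomial of degree d - k in q, q², …, q ^ d; it is 0 for k > d.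
  elem : ℕ → ℕ → Carrier
  elem zero    zero    = 1#
  elem zero    (suc k) = 0#
  elem (suc d) k       = prev (elem d) k + q ^ suc d * elem d k

  elem-zero : ∀ {d k} → d ℕ.< k → elem d k ≈ 0#
  elem-zero {zero}  {suc k} _         = refl
  elem-zero {suc d} {suc k} (s≤s d<k) = begin
    elem d k + q ^ suc d * elem d (suc k)  ≈⟨ +-cong (elem-zero d<k) (*-congˡ (elem-zero (ℕ.m≤n⇒m≤1+n d<k))) ⟩
    0# + q ^ suc d * 0#                    ≈⟨ +-identityˡ _ ⟩
    q ^ suc d * 0#                         ≈⟨ zeroʳ _ ⟩
    0#                                     ∎

  -- By the q-binomial theorem `elem d k` is q^((d-k)(d-k+1)/2) times the q-binomial coefficient of
  -- d over k, and the identity compares two neighbouring coefficients. Avoiding division, the proof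
  -- is an induction on d from the recurrence of `elem`.
  elem-shift : ∀ d k → [ suc k ]q * (q ^ (d ∸ k) * elem d (suc k)) ≈ [ d ∸ k ]q * elem d k
  elem-shift zero k rewrite ℕ.0∸n≡0 k = begin
    [ suc k ]q * (1# * 0#)  ≈⟨ *-congˡ (zeroʳ 1#) ⟩
    [ suc k ]q * 0#         ≈⟨ zeroʳ _ ⟩
    0#                      ≈⟨ zeroˡ _ ⟨
    0# * elem zero k        ∎
  elem-shift (suc d) zero = begin
    [ 1 ]q * (q * Q * (a + q * Q * b))           ≈⟨ *-congʳ [1]q ⟩
    1# * (q * Q * (a + q * Q * b))               ≈⟨ solve 4 (λ q Q a b → con 1 :* (q :* Q :* (a :+ q :* Q :* b)) := q :* Q :* (a :+ q :* (con 1 :* (Q :* b)))) refl q Q a b ⟩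
    q * Q * (a + q * (1# * (Q * b)))             ≈⟨ *-congˡ (+-congˡ (*-congˡ (trans (*-congʳ (sym [1]q)) (elem-shift d 0)))) ⟩
    q * Q * (a + q * ([ d ]q * a))               ≈⟨ solve 4 (λ q Q a D → q :* Q :* (a :+ q :* (D :* a)) := (con 1 :+ q :* D) :* (con 0 :+ q :* Q :* a)) refl q Q a [ d ]q ⟩
    (1# + q * [ d ]q) * (0# + q * Q * a)         ≈⟨ *-congʳ ([]q-suc d) ⟨
    [ suc d ]q * (0# + q * Q * a)                ∎
    where
    Q = q ^ d
    a = elem d 0
    b = elem d 1
  elem-shift (suc d) (suc k) with ℕ.≤-<-connex (suc k) d
  ... | inj₁ k<d = begin
    [ suc (suc k) ]q * (q ^ (d ∸ k) * (a + q * Q * b))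
      ≡⟨ ≡.cong (λ i → [ suc (suc k) ]q * (q ^ i * (a + q * Q * b))) d∸k ⟩
    [ suc (suc k) ]q * (q * E * (a + q * Q * b))
      ≈⟨ solve 6 (λ q Q E a b K → K :* (q :* E :* (a :+ q :* Q :* b)) := K :* (q :* E :* a) :+ q :* (q :* Q) :* (K :* (E :* b)))
           refl q Q E a b [ suc (suc k) ]q ⟩
    [ suc (suc k) ]q * (q * E * a) + q * (q * Q) * ([ suc (suc k) ]q * (E * b))
      -- The bracket [k+2] is split in the first summand only: its part [k+1] meets the induction
      -- hypothesis at k, while q^(k+1) completes E to q^d. The second summand is the induction
      -- hypothesis at k+1 as it stands.
      ≈⟨ +-cong (*-congʳ ([]q-sucʳ (suc k))) (*-congˡ (elem-shift d (suc k))) ⟩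
    ([ suc k ]q + q ^ suc k) * (q * E * a) + q * (q * Q) * (D * a)
      ≈⟨ solve 7 (λ q Q E a K L D → (K :+ L) :* (q :* E :* a) :+ q :* (q :* Q) :* (D :* a)
                    := K :* (q :* E :* a) :+ (q :* (L :* E) :* a :+ q :* (q :* Q) :* (D :* a)))
           refl q Q E a [ suc k ]q (q ^ suc k) D ⟩
    [ suc k ]q * (q * E * a) + (q * (q ^ suc k * E) * a + q * (q * Q) * (D * a))
      ≈⟨ +-cong (reflexive (≡.cong (λ i → [ suc k ]q * (q ^ i * a)) (≡.sym d∸k))) (+-congʳ (*-congʳ (*-congˡ LE))) ⟩
    [ suc k ]q * (q ^ (d ∸ k) * a) + (q * Q * a + q * (q * Q) * (D * a))
      ≈⟨ +-congʳ (elem-shift d k) ⟩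
    [ d ∸ k ]q * e + (q * Q * a + q * (q * Q) * (D * a))
      ≈⟨ +-congˡ (solve 4 (λ q Q a D → q :* Q :* a :+ q :* (q :* Q) :* (D :* a) := (con 1 :+ q :* D) :* (q :* Q :* a)) refl q Q a D) ⟩
    [ d ∸ k ]q * e + (1# + q * D) * (q * Q * a)
      ≈⟨ +-congˡ (*-congʳ (trans (sym ([]q-suc (d ∸ suc k))) (reflexive (≡.cong [_]q (≡.sym d∸k))))) ⟩
    [ d ∸ k ]q * e + [ d ∸ k ]q * (q * Q * a)
      ≈⟨ distribˡ _ _ _ ⟨
    [ d ∸ k ]q * (e + q * Q * a)
      ∎
    where
    Q = q ^ d
    E = q ^ (d ∸ suc k)
    D = [ d ∸ suc k ]q
    e = elem d k
    a = elem d (suc k)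
    b = elem d (suc (suc k))
    d∸k : d ∸ k ≡ suc (d ∸ suc k)
    d∸k = ℕ.+-∸-assoc 1 k<d
    LE : q ^ suc k * E ≈ Q
    LE = trans (sym (^-homo-* q (suc k) (d ∸ suc k))) (reflexive (≡.cong (q ^_) (ℕ.m+[n∸m]≡n k<d)))
  ... | inj₂ (s≤s d≤k) rewrite ℕ.m≤n⇒m∸n≡0 d≤k = begin
    [ suc (suc k) ]q * (1# * (elem d (suc k) + q ^ suc d * elem d (suc (suc k))))
      ≈⟨ *-congˡ (*-congˡ (elem-zero {suc d} {suc (suc k)} (s≤s (s≤s d≤k)))) ⟩
    [ suc (suc k) ]q * (1# * 0#)  ≈⟨ *-congˡ (zeroʳ 1#) ⟩
    [ suc (suc k) ]q * 0#         ≈⟨ zeroʳ _ ⟩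
    0#                            ≈⟨ zeroˡ _ ⟨
    0# * elem (suc d) (suc k)     ∎

  -- Insertion yields [d+1] with d descents and [n-d] with d+1; the combined factor must be
  -- independent of d. Expanding `elem (suc d) k` collects [n+1] in front of `elem d k`. For
  -- positive k this is split anew as [n+1-k] + q^(n+1-k) [k], and `elem-shift` moves the second
  -- part to `elem d (k-1)`, where it completes [n-d] to [n+1-k].
  elem-recurrence : ∀ {d n} k → d ℕ.≤ n →
    [ suc d ]q * elem d k + [ n ∸ d ]q * elem (suc d) k ≈ [ suc n ∸ k ]q * (elem d k + prev (elem d) k)
  elem-recurrence {d} {n} zero d≤n = begin
    [ suc d ]q * a + [ n ∸ d ]q * (0# + q ^ suc d * a)
      ≈⟨ solve 4 (λ D N Q a → D :* a :+ N :* (con 0 :+ Q :* a) := (D :+ Q :* N) :* (a :+ con 0)) refl [ suc d ]q [ n ∸ d ]q (q ^ suc d) a ⟩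
    ([ suc d ]q + q ^ suc d * [ n ∸ d ]q) * (a + 0#)
      ≈⟨ *-congʳ ([]q-+ (suc d) (n ∸ d)) ⟨
    [ suc (d ℕ.+ (n ∸ d)) ]q * (a + 0#)
      ≡⟨ ≡.cong (λ m → [ suc m ]q * (a + 0#)) (ℕ.m+[n∸m]≡n d≤n) ⟩
    [ suc n ]q * (a + 0#) ∎
    where a = elem d 0
  elem-recurrence {d} {n} (suc k) d≤n with ℕ.≤-<-connex k d
  ... | inj₂ d<k = trans
    (trans (+-cong (trans (*-congˡ a≈0) (zeroʳ _)) (trans (*-congˡ (elem-zero {suc d} (s≤s d<k))) (zeroʳ _))) (+-identityʳ 0#))
    (sym (trans (*-congˡ (trans (+-cong a≈0 (elem-zero d<k)) (+-identityʳ 0#))) (zeroʳ _)))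
    where
    a≈0 : elem d (suc k) ≈ 0#
    a≈0 = elem-zero (ℕ.m≤n⇒m≤1+n d<k)
  ... | inj₁ k≤d = begin
    [ suc d ]q * a + N * (e + q ^ suc d * a)
      ≈⟨ solve 5 (λ D N Q a e → D :* a :+ N :* (e :+ Q :* a) := (D :+ Q :* N) :* a :+ N :* e) refl [ suc d ]q N (q ^ suc d) a e ⟩
    ([ suc d ]q + q ^ suc d * N) * a + N * e
      ≈⟨ +-congʳ (*-congʳ ([]q-+ (suc d) (n ∸ d))) ⟨
    [ suc (d ℕ.+ (n ∸ d)) ]q * a + N * e
      ≡⟨ ≡.cong (λ m → [ m ]q * a + N * e) n+1 ⟩
    [ (n ∸ k) ℕ.+ suc k ]q * a + N * e
      ≈⟨ +-congʳ (*-congʳ ([]q-+ (n ∸ k) (suc k))) ⟩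
    ([ n ∸ k ]q + q ^ (n ∸ k) * [ suc k ]q) * a + N * e
      ≡⟨ ≡.cong (λ m → ([ n ∸ k ]q + q ^ m * [ suc k ]q) * a + N * e) n∸k ⟩
    ([ n ∸ k ]q + q ^ ((n ∸ d) ℕ.+ (d ∸ k)) * [ suc k ]q) * a + N * e
      ≈⟨ +-congʳ (*-congʳ (+-congˡ (*-congʳ (^-homo-* q (n ∸ d) (d ∸ k))))) ⟩
    ([ n ∸ k ]q + P * E * [ suc k ]q) * a + N * e
      ≈⟨ solve 7 (λ M P E K a N e → (M :+ P :* E :* K) :* a :+ N :* e := M :* a :+ (P :* (K :* (E :* a)) :+ N :* e))
           refl [ n ∸ k ]q P E [ suc k ]q a N e ⟩
    [ n ∸ k ]q * a + (P * ([ suc k ]q * (E * a)) + N * e)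
      ≈⟨ +-congˡ (+-congʳ (*-congˡ (elem-shift d k))) ⟩
    [ n ∸ k ]q * a + (P * ([ d ∸ k ]q * e) + N * e)
      ≈⟨ +-congˡ (solve 4 (λ P D N e → P :* (D :* e) :+ N :* e := (N :+ P :* D) :* e) refl P [ d ∸ k ]q N e) ⟩
    [ n ∸ k ]q * a + (N + P * [ d ∸ k ]q) * e
      ≈⟨ +-congˡ (*-congʳ (trans (sym ([]q-+ (n ∸ d) (d ∸ k))) (reflexive (≡.cong [_]q (≡.sym n∸k))))) ⟩
    [ n ∸ k ]q * a + [ n ∸ k ]q * e
      ≈⟨ distribˡ _ _ _ ⟨
    [ n ∸ k ]q * (a + e) ∎
    where
    a = elem d (suc k)
    e = elem d k
    N = [ n ∸ d ]q
    P = q ^ (n ∸ d)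
    E = q ^ (d ∸ k)
    n∸k : n ∸ k ≡ (n ∸ d) ℕ.+ (d ∸ k)
    n∸k = ≡.trans (≡.cong (_∸ k) (≡.sym (ℕ.m∸n+n≡m d≤n))) (ℕ.+-∸-assoc (n ∸ d) k≤d)
    n+1 : suc (d ℕ.+ (n ∸ d)) ≡ (n ∸ k) ℕ.+ suc k
    n+1 = ≡.trans (≡.cong suc (≡.trans (ℕ.m+[n∸m]≡n d≤n) (≡.sym (ℕ.m∸n+n≡m (ℕ.≤-trans k≤d d≤n)))))
                  (≡.sym (ℕ.+-suc (n ∸ k) k))

  -- The major index under insertion

  majSum : ∀ {n} → ℕ → Subset n → Carrier
  majSum {n} k D = ∑Subset n (λ S → guard (S ⊑ᵇ D) (guard (∣ S ∣ ≡ᵇ k) (q ^ starredMaj D S)))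

  q^-+ : ∀ a b x → q ^ (a ℕ.+ b) * x ≈ q ^ a * (q ^ b * x)
  q^-+ a b x = trans (*-congʳ (^-homo-* q a b)) (*-assoc _ _ _)

  -- A descent at the head has exponent ∣ D ∣ + 1, the newest variable of `elem`. Left unstarred it
  -- contributes this variable; starred it omits it and uses up one of the k stars, which gives the
  -- `prev` term.
  majSum-elem : ∀ {n} (D : Subset n) k → majSum k D ≈ q ^ nonDescentWeight D * elem ∣ D ∣ k

  prev-majSum : ∀ {n} (D : Subset n) k → prev (λ j → majSum j D) k ≈ q ^ nonDescentWeight D * prev (elem ∣ D ∣) k
  prev-majSum D zero    = sym (zeroʳ _)
  prev-majSum D (suc k) = majSum-elem D k

  majSum-elem []      zero    = trans (+-identityʳ 1#) (sym (*-identityˡ 1#))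
  majSum-elem []      (suc k) = trans (+-identityʳ 0#) (sym (*-identityˡ 0#))
  majSum-elem {suc n} (d ∷ D) k = begin
    majSum k (d ∷ D)
      ≈⟨ ∑Subset-suc n _ ⟩
    ∑Subset n (λ S → guard (d ∧ (S ⊑ᵇ D)) (guard (suc ∣ S ∣ ≡ᵇ k) (q ^ starredMaj D S)))
    + ∑Subset n (λ S → guard (S ⊑ᵇ D) (guard (∣ S ∣ ≡ᵇ k) (q ^ (∣ d ∷ D ∣ ℕ.+ starredMaj D S))))
      ≈⟨ +-cong (starred d k) (trans (∑-cong (allVecs bools n) pull) (∑-*ˡ (allVecs bools n) (q ^ ∣ d ∷ D ∣) _)) ⟩
    guard d (prev (λ j → majSum j D) k) + q ^ ∣ d ∷ D ∣ * majSum k D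
      ≈⟨ finish d ⟩
    q ^ nonDescentWeight (d ∷ D) * elem ∣ d ∷ D ∣ k ∎
    where
    Q = q ^ nonDescentWeight D
    starred : ∀ d k → ∑Subset n (λ S → guard (d ∧ (S ⊑ᵇ D)) (guard (suc ∣ S ∣ ≡ᵇ k) (q ^ starredMaj D S)))
                      ≈ guard d (prev (λ j → majSum j D) k)
    starred false k       = ∑-0 (allVecs bools n) (λ _ → refl)
    starred true  zero    = ∑-0 (allVecs bools n) (λ S → guard-0 (S ⊑ᵇ D))
    starred true  (suc k) = refl
    pull : ∀ S → guard (S ⊑ᵇ D) (guard (∣ S ∣ ≡ᵇ k) (q ^ (∣ d ∷ D ∣ ℕ.+ starredMaj D S)))
               ≈ q ^ ∣ d ∷ D ∣ * guard (S ⊑ᵇ D) (guard (∣ S ∣ ≡ᵇ k) (q ^ starredMaj D S))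
    pull S = begin
      guard a (guard b (q ^ (∣ d ∷ D ∣ ℕ.+ starredMaj D S)))
        ≈⟨ guard-cong a (λ _ → trans (guard-cong b (λ _ → ^-homo-* q ∣ d ∷ D ∣ _)) (guard-* b _ _)) ⟩
      guard a (q ^ ∣ d ∷ D ∣ * guard b (q ^ starredMaj D S))
        ≈⟨ guard-* a _ _ ⟩
      q ^ ∣ d ∷ D ∣ * guard a (guard b (q ^ starredMaj D S)) ∎
      where
      a = S ⊑ᵇ D
      b = ∣ S ∣ ≡ᵇ k
    finish : ∀ d → guard d (prev (λ j → majSum j D) k) + q ^ ∣ d ∷ D ∣ * majSum k D
                 ≈ q ^ nonDescentWeight (d ∷ D) * elem ∣ d ∷ D ∣ k
    finish true  = begin
      prev (λ j → majSum j D) k + q ^ suc ∣ D ∣ * majSum k D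
        ≈⟨ +-cong (prev-majSum D k) (*-congˡ (majSum-elem D k)) ⟩
      Q * prev (elem ∣ D ∣) k + q ^ suc ∣ D ∣ * (Q * elem ∣ D ∣ k)
        ≈⟨ solve 4 (λ Q a P b → Q :* a :+ P :* (Q :* b) := Q :* (a :+ P :* b)) refl Q _ _ _ ⟩
      Q * elem (suc ∣ D ∣) k ∎
    finish false = begin
      0# + q ^ ∣ D ∣ * majSum k D                                 ≈⟨ +-identityˡ _ ⟩
      q ^ ∣ D ∣ * majSum k D                                      ≈⟨ *-congˡ (majSum-elem D k) ⟩
      q ^ ∣ D ∣ * (Q * elem ∣ D ∣ k)                              ≈⟨ q^-+ ∣ D ∣ _ _ ⟨
      q ^ (∣ D ∣ ℕ.+ nonDescentWeight D) * elem ∣ D ∣ k           ∎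

  -- Of the n nonzero insertion places, those in descents leave the number of descents unchanged and raise the
  -- major index by 1, …, ∣ D ∣ (the last place raises it by 0); the others create a descent.
  sum-insertDescent-suc : ∀ {n} (D : Subset (suc n)) (φ : ℕ → Carrier) → LastOut D →
    sum {suc n} (λ p → φ ∣ insertDescent (suc p) D ∣ * q ^ nonDescentWeight (insertDescent (suc p) D)) ≈
    q ^ nonDescentWeight D * ([ suc ∣ D ∣ ]q * φ ∣ D ∣ + q * ([ n ∸ ∣ D ∣ ]q * φ (suc ∣ D ∣)))
  sum-insertDescent-suc (true ∷ [])  φ ()
  sum-insertDescent-suc (false ∷ []) φ _  = begin
    φ 0 * 1# + 0#                                ≈⟨ solve 3 (λ q a b → a :* con 1 :+ con 0 := con 1 :* (con 1 :* a :+ q :* (con 0 :* b))) refl q (φ 0) (φ 1) ⟩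
    1# * (1# * φ 0 + q * (0# * φ 1))             ≈⟨ *-congˡ (+-congʳ (*-congʳ [1]q)) ⟨
    1# * ([ 1 ]q * φ 0 + q * (0# * φ 1))         ∎
  sum-insertDescent-suc {suc n} (true ∷ T@(_ ∷ _)) φ out = begin
    φ (suc d) * q ^ (suc d ℕ.+ e) + sum {suc n} (λ p → φ (suc ∣ insertDescent (suc p) T ∣) * q ^ nonDescentWeight (insertDescent (suc p) T))
      ≈⟨ +-cong (*-congˡ (^-homo-* q (suc d) e)) (sum-insertDescent-suc T (φ ∘ suc) out) ⟩
    φ (suc d) * (q ^ suc d * q ^ e) + q ^ e * ([ suc d ]q * φ (suc d) + q * (N * φ (suc (suc d))))
      ≈⟨ solve 7 (λ q f D E K N g → f :* (D :* E) :+ E :* (K :* f :+ q :* (N :* g)) := E :* ((K :+ D) :* f :+ q :* (N :* g)))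
           refl q (φ (suc d)) (q ^ suc d) (q ^ e) [ suc d ]q N (φ (suc (suc d))) ⟩
    q ^ e * (([ suc d ]q + q ^ suc d) * φ (suc d) + q * (N * φ (suc (suc d))))
      -- The place just behind the leading descent supplies the top power that extends [d+1] to
      -- [d+2].
      ≈⟨ *-congˡ (+-congʳ (*-congʳ ([]q-sucʳ (suc d)))) ⟨
    q ^ e * ([ suc (suc d) ]q * φ (suc d) + q * (N * φ (suc (suc d)))) ∎
    where
    d = ∣ T ∣
    e = nonDescentWeight T
    N = [ n ∸ d ]q
  sum-insertDescent-suc {suc n} (false ∷ T@(_ ∷ _)) φ out = begin
    φ (suc d) * q ^ (suc d ℕ.+ e) + sum {suc n} (λ p → φ ∣ ins p ∣ * q ^ (∣ ins p ∣ ℕ.+ nonDescentWeight (ins p)))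
      ≈⟨ +-cong (*-congˡ (^-homo-* q (suc d) e))
           (trans (sum-cong (suc n) (λ p → φ-pull ∣ ins p ∣ (nonDescentWeight (ins p))))
                  -- A non-descent at the head adds the number m of descents behind it to the
                  -- weight. The factor q^m is absorbed into φ, which is why φ is arbitrary.
                  (sum-insertDescent-suc T (λ m → φ m * q ^ m) out)) ⟩
    φ (suc d) * (q * D * E) + E * ([ suc d ]q * (φ d * D) + q * (N * (φ (suc d) * (q * D))))
      ≈⟨ solve 7 (λ q f D E K N g → g :* (q :* D :* E) :+ E :* (K :* (f :* D) :+ q :* (N :* (g :* (q :* D))))
                                    := D :* E :* (K :* f :+ q :* ((con 1 :+ q :* N) :* g)))
           refl q (φ d) D E [ suc d ]q N (φ (suc d)) ⟩
    D * E * ([ suc d ]q * φ d + q * ((1# + q * N) * φ (suc d)))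
      ≈⟨ *-cong (^-homo-* q d e) (+-congˡ (*-congˡ (*-congʳ (trans (reflexive (≡.cong [_]q n∸d)) ([]q-suc (n ∸ d)))))) ⟨
    q ^ (d ℕ.+ e) * ([ suc d ]q * φ d + q * ([ suc n ∸ d ]q * φ (suc d))) ∎
    where
    d = ∣ T ∣
    e = nonDescentWeight T
    D = q ^ d
    E = q ^ e
    N = [ n ∸ d ]q
    φ-pull : ∀ i j → φ i * q ^ (i ℕ.+ j) ≈ φ i * q ^ i * q ^ j
    φ-pull i j = trans (*-congˡ (^-homo-* q i j)) (sym (*-assoc _ _ _))
    ins : Fin (suc n) → Subset (suc (suc n))
    ins p = insertDescent (suc p) T
    n∸d : suc n ∸ d ≡ suc (n ∸ d)
    n∸d = ℕ.+-∸-assoc 1 (ℕ.≤-pred (lastOut⇒∣∣< T out))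

  -- Place zero is treated apart because gap zero of a tail is the gap behind the head, which alters
  -- the head. On a nonempty word it creates a descent at no cost in weight, the constant term
  -- missing from the second bracket.
  sum-insertDescent : ∀ {n} (D : Subset n) (φ : ℕ → Carrier) → LastOut D →
    sum {suc n} (λ p → q ^ nonDescentWeight (insertDescent p D) * φ ∣ insertDescent p D ∣) ≈
    q ^ nonDescentWeight D * ([ suc ∣ D ∣ ]q * φ ∣ D ∣ + [ n ∸ ∣ D ∣ ]q * φ (suc ∣ D ∣))
  sum-insertDescent []  φ _ = begin
    1# * φ 0 + 0#                         ≈⟨ solve 2 (λ a b → con 1 :* a :+ con 0 := con 1 :* (con 1 :* a :+ con 0 :* b)) refl (φ 0) (φ 1) ⟩
    1# * (1# * φ 0 + 0# * φ 1)            ≈⟨ *-congˡ (+-congʳ (*-congʳ [1]q)) ⟨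
    1# * ([ 1 ]q * φ 0 + 0# * φ 1)        ∎
  sum-insertDescent {suc n} D@(_ ∷ _) φ out = begin
    q ^ e * φ (suc d) + sum {suc n} (λ p → q ^ nonDescentWeight (insertDescent (suc p) D) * φ ∣ insertDescent (suc p) D ∣)
      ≈⟨ +-congˡ (trans (sum-cong (suc n) (λ p → *-comm (q ^ nonDescentWeight (insertDescent (suc p) D)) (φ ∣ insertDescent (suc p) D ∣))) (sum-insertDescent-suc D φ out)) ⟩
    q ^ e * φ (suc d) + q ^ e * ([ suc d ]q * φ d + q * (N * φ (suc d)))
      ≈⟨ solve 6 (λ q E K f N g → E :* g :+ E :* (K :* f :+ q :* (N :* g)) := E :* (K :* f :+ (con 1 :+ q :* N) :* g))
           refl q (q ^ e) [ suc d ]q (φ d) N (φ (suc d)) ⟩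
    q ^ e * ([ suc d ]q * φ d + (1# + q * N) * φ (suc d))
      ≈⟨ *-congˡ (+-congˡ (*-congʳ (trans (reflexive (≡.cong [_]q n∸d)) ([]q-suc (n ∸ d))))) ⟨
    q ^ e * ([ suc d ]q * φ d + [ suc n ∸ d ]q * φ (suc d)) ∎
    where
    d = ∣ D ∣
    e = nonDescentWeight D
    N = [ n ∸ d ]q
    n∸d : suc n ∸ d ≡ suc (n ∸ d)
    n∸d = ℕ.+-∸-assoc 1 (ℕ.≤-pred (lastOut⇒∣∣< D out))

  majSum-insert : ∀ {n} (D : Subset n) k → LastOut D →
    sum {suc n} (λ p → majSum k (insertDescent p D)) ≈ [ suc n ∸ k ]q * (majSum k D + prev (λ j → majSum j D) k)
  majSum-insert {n} D k out = begin
    sum {suc n} (λ p → majSum k (insertDescent p D))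
      ≈⟨ sum-cong (suc n) (λ p → majSum-elem (insertDescent p D) k) ⟩
    sum {suc n} (λ p → q ^ nonDescentWeight (insertDescent p D) * elem ∣ insertDescent p D ∣ k)
      ≈⟨ sum-insertDescent D (λ d → elem d k) out ⟩
    Q * ([ suc ∣ D ∣ ]q * elem ∣ D ∣ k + [ n ∸ ∣ D ∣ ]q * elem (suc ∣ D ∣) k)
      ≈⟨ *-congˡ (elem-recurrence k (∣p∣≤n D)) ⟩
    Q * ([ suc n ∸ k ]q * (elem ∣ D ∣ k + prev (elem ∣ D ∣) k))
      ≈⟨ solve 4 (λ Q N a b → Q :* (N :* (a :+ b)) := N :* (Q :* a :+ Q :* b)) refl Q [ suc n ∸ k ]q _ _ ⟩
    [ suc n ∸ k ]q * (Q * elem ∣ D ∣ k + Q * prev (elem ∣ D ∣) k)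
      ≈⟨ *-congˡ (+-cong (majSum-elem D k) (prev-majSum D k)) ⟨
    [ suc n ∸ k ]q * (majSum k D + prev (λ j → majSum j D) k) ∎
    where
    Q = q ^ nonDescentWeight D

  -- The inversion statistic under insertion

  guard-comm : ∀ a b x → guard a (guard b x) ≈ guard b (guard a x)
  guard-comm true  b x = refl
  guard-comm false b x = sym (guard-0 b)

  -- The free gaps other than zero are those just behind an unstarred letter. From right to left
  -- their exponents are 0, 1, 2, and so on, one for each unstarred letter.
  sum-isFree-suc : ∀ {n} (S : Subset n) → sum {n} (λ p → guard (isFree S (suc p)) (q ^ unstarredFrom S (suc p))) ≈ [ unstarred S ]q
  sum-isFree-suc []          = refl
  sum-isFree-suc (true ∷ S)  = trans (+-identityˡ _) (sum-isFree-suc S)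
  sum-isFree-suc (false ∷ S) = trans (trans (+-comm _ _) (+-congʳ (sum-isFree-suc S))) (sym ([]q-sucʳ (unstarred S)))

  sum-isFree : ∀ {n} (S : Subset n) → sum {suc n} (λ p → guard (isFree S p) (q ^ unstarredFrom S p)) ≈ [ suc (unstarred S) ]q
  sum-isFree S = trans (trans (+-comm _ _) (+-congʳ (sum-isFree-suc S))) (sym ([]q-sucʳ (unstarred S)))

  -- The exponent is lowered by one because the new star raises the subtracted cardinality by one.
  freeNotLast : ∀ {n} → Subset n → Fin (suc n) → Carrier
  freeNotLast S p = guard (isFree S p) (guard (notLast p) (q ^ (unstarredFrom S p ∸ 1)))

  []q-pred : ∀ {m} → 0 ℕ.< m → q ^ (m ∸ 1) + [ m ∸ 1 ]q ≈ [ m ]q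
  []q-pred {suc m} _ = trans (+-comm _ _) (sym ([]q-sucʳ m))

  -- On a nonempty word the end is a free gap, the one with exponent 0. Without it, and with the
  -- other exponents lowered by one, the values again start at 0, and there is one fewer.
  sum-freeNotLast-suc : ∀ {n} (S : Subset n) → LastOut S → sum {n} (λ p → freeNotLast S (suc p)) ≈ [ unstarred S ∸ 1 ]q
  sum-freeNotLast-suc []              _   = refl
  sum-freeNotLast-suc (true ∷ [])     ()
  sum-freeNotLast-suc (false ∷ [])    _   = +-identityʳ 0#
  sum-freeNotLast-suc (true ∷ s ∷ S)  out = trans (+-identityˡ _) (sum-freeNotLast-suc (s ∷ S) out)
  sum-freeNotLast-suc (false ∷ s ∷ S) out =
    trans (+-congˡ (sum-freeNotLast-suc (s ∷ S) out)) ([]q-pred (lastOut⇒unstarred>0 (s ∷ S) out))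

  sum-freeNotLast : ∀ {n} (S : Subset n) → LastOut S → sum {suc n} (freeNotLast S) ≈ [ unstarred S ]q
  sum-freeNotLast []      _   = +-identityʳ 0#
  sum-freeNotLast (s ∷ S) out =
    trans (+-congˡ (sum-freeNotLast-suc (s ∷ S) out)) ([]q-pred (lastOut⇒unstarred>0 (s ∷ S) out))

  invTerm : ∀ {n} → ℕ → Vec ℕ n → Subset n → Carrier
  invTerm k w S = guard (S ⊑ᵇ descents w) (guard (∣ S ∣ ≡ᵇ k) (q ^ (unstarredInv w S ∸ ∣ S ∣)))

  invSum : ∀ {n} → ℕ → Vec ℕ n → Carrier
  invSum {n} k w = ∑Subset n (λ S → guard (S ⊑ᵇ descents w) (guard (∣ S ∣ ≡ᵇ k) (q ^ (unstarredInv w S ∸ ∣ S ∣))))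

  -- A maximal letter can be put in any of the n + 1 ∸ ∣ S ∣ places that are not just behind a star, and then be
  -- starred unless it is last; it adds an inversion for each unstarred position behind it.
  invSum-insert : ∀ {n} (w : Vec ℕ n) k {M} → All (ℕ._< M) w →
    sum {suc n} (λ p → invSum k (insertAt w p M)) ≈ [ suc n ∸ k ]q * (invSum k w + prev (λ j → invSum j w) k)
  invSum-insert {n} w k {M} w<M = begin
    sum {suc n} (λ p → invSum k (insertAt w p M))
      ≈⟨ sum-cong (suc n) (λ p → trans (∑Subset-insertAt p (invTerm k (insertAt w p M))) (+-comm _ _)) ⟩
    sum {suc n} (λ p → ∑Subset n (λ S → F p S false) + ∑Subset n (λ S → F p S true))
      ≈⟨ sum-+ (suc n) (λ p → ∑Subset n (λ S → F p S false)) (λ p → ∑Subset n (λ S → F p S true)) ⟩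
    sum {suc n} (λ p → ∑Subset n (λ S → F p S false)) + sum {suc n} (λ p → ∑Subset n (λ S → F p S true))
      ≈⟨ +-cong (∑-sum-comm (allVecs bools n) (λ S p → F p S false)) (∑-sum-comm (allVecs bools n) (λ S p → F p S true)) ⟨
    ∑Subset n (λ S → sum {suc n} (λ p → F p S false)) + ∑Subset n (λ S → sum {suc n} (λ p → F p S true))
      ≈⟨ +-cong (∑-cong (allVecs bools n) unstar) (∑-cong (allVecs bools n) star) ⟩
    ∑Subset n (λ S → N * G S k) + ∑Subset n (λ S → N * prev (G S) k)
      ≈⟨ +-cong (∑-*ˡ (allVecs bools n) N _) (∑-*ˡ (allVecs bools n) N _) ⟩
    N * invSum k w + N * ∑Subset n (λ S → prev (G S) k)
      ≈⟨ +-congˡ (*-congˡ (∑-prev k)) ⟩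
    N * invSum k w + N * prev (λ j → invSum j w) k
      ≈⟨ distribˡ N _ _ ⟨
    N * (invSum k w + prev (λ j → invSum j w) k) ∎
    where
    N = [ suc n ∸ k ]q
    D = descents w
    J = unstarredInv w
    F : Fin (suc n) → Subset n → Bool → Carrier
    F p S s = invTerm k (insertAt w p M) (insertAt S p s)
    G : Subset n → ℕ → Carrier
    G S j = invTerm j w S
    ∑-prev : ∀ k → ∑Subset n (λ S → prev (G S) k) ≈ prev (λ j → invSum j w) k
    ∑-prev zero    = ∑-0 (allVecs bools n) (λ _ → refl)
    ∑-prev (suc k) = refl

    module _ (S : Subset n) (S⊑D : S ⊑ᵇ D ≡ true) where

      out : LastOut S
      out = ⊑ᵇ-lastOut S D S⊑D (descents-lastOut w)

      ∣S∣≤J : ∣ S ∣ ℕ.≤ J S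
      ∣S∣≤J = ∣∣≤unstarredInv w S S⊑D

      unstar-sum : guard (∣ S ∣ ≡ᵇ k) (sum {suc n} (λ p → guard (isFree S p) (q ^ ((J S ℕ.+ unstarredFrom S p) ∸ ∣ S ∣))))
                 ≈ N * guard (∣ S ∣ ≡ᵇ k) (q ^ (J S ∸ ∣ S ∣))
      unstar-sum = trans (guard-cong (∣ S ∣ ≡ᵇ k) (λ e → begin
        sum {suc n} (λ p → guard (isFree S p) (q ^ ((J S ℕ.+ unstarredFrom S p) ∸ ∣ S ∣)))
          ≈⟨ sum-cong (suc n) (λ p → trans (guard-cong (isFree S p) (λ _ → exponent (unstarredFrom S p))) (guard-* (isFree S p) _ _)) ⟩
        sum {suc n} (λ p → q ^ (J S ∸ ∣ S ∣) * guard (isFree S p) (q ^ unstarredFrom S p))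
          ≈⟨ sum-*ˡ (suc n) _ (λ p → guard (isFree S p) (q ^ unstarredFrom S p)) ⟩
        q ^ (J S ∸ ∣ S ∣) * sum {suc n} (λ p → guard (isFree S p) (q ^ unstarredFrom S p))
          ≈⟨ *-congˡ (sum-isFree S) ⟩
        q ^ (J S ∸ ∣ S ∣) * [ suc (unstarred S) ]q
          ≡⟨ ≡.cong (λ m → q ^ (J S ∸ ∣ S ∣) * [ m ]q) (places e) ⟩
        q ^ (J S ∸ ∣ S ∣) * N
          ≈⟨ *-comm _ _ ⟩
        N * q ^ (J S ∸ ∣ S ∣) ∎)) (guard-* (∣ S ∣ ≡ᵇ k) _ _)
        where
        exponent : ∀ u → q ^ ((J S ℕ.+ u) ∸ ∣ S ∣) ≈ q ^ (J S ∸ ∣ S ∣) * q ^ u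
        exponent u = trans (reflexive (≡.cong (q ^_) (ℕ.+-∸-comm u ∣S∣≤J))) (^-homo-* q (J S ∸ ∣ S ∣) u)
        places : (∣ S ∣ ≡ᵇ k) ≡ true → suc (unstarred S) ≡ suc n ∸ k
        places e = ≡.trans (≡.cong suc (unstarred≡n∸∣∣ S))
          (≡.trans (≡.sym (ℕ.+-∸-assoc 1 (∣p∣≤n S))) (≡.cong (suc n ∸_) (≡ᵇ≡true⇒≡ ∣ S ∣ k e)))

      star-sum : guard (suc ∣ S ∣ ≡ᵇ k) (sum {suc n} (λ p → guard (isFree S p) (guard (notLast p) (q ^ ((J S ℕ.+ unstarredFrom S p) ∸ suc ∣ S ∣)))))
               ≈ N * guard (suc ∣ S ∣ ≡ᵇ k) (q ^ (J S ∸ ∣ S ∣))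
      star-sum = trans (guard-cong (suc ∣ S ∣ ≡ᵇ k) (λ e → begin
        sum {suc n} (λ p → guard (isFree S p) (guard (notLast p) (q ^ ((J S ℕ.+ unstarredFrom S p) ∸ suc ∣ S ∣))))
          ≈⟨ sum-cong (suc n) (λ p → trans (guard-cong (isFree S p) (λ _ →
               trans (guard-cong (notLast p) (λ i → exponent _ (notLast⇒unstarredFrom>0 S p out i))) (guard-* (notLast p) _ _)))
               (guard-* (isFree S p) _ _)) ⟩
        sum {suc n} (λ p → q ^ (J S ∸ ∣ S ∣) * freeNotLast S p)
          ≈⟨ sum-*ˡ (suc n) _ (freeNotLast S) ⟩
        q ^ (J S ∸ ∣ S ∣) * sum {suc n} (freeNotLast S)
          ≈⟨ *-congˡ (sum-freeNotLast S out) ⟩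
        q ^ (J S ∸ ∣ S ∣) * [ unstarred S ]q
          ≡⟨ ≡.cong (λ m → q ^ (J S ∸ ∣ S ∣) * [ m ]q) (places e) ⟩
        q ^ (J S ∸ ∣ S ∣) * N
          ≈⟨ *-comm _ _ ⟩
        N * q ^ (J S ∸ ∣ S ∣) ∎)) (guard-* (suc ∣ S ∣ ≡ᵇ k) _ _)
        where
        exponent : ∀ u → 0 ℕ.< u → q ^ ((J S ℕ.+ u) ∸ suc ∣ S ∣) ≈ q ^ (J S ∸ ∣ S ∣) * q ^ (u ∸ 1)
        exponent (suc u) _ = trans
          (reflexive (≡.cong (q ^_) (≡.trans (≡.cong (_∸ suc ∣ S ∣) (ℕ.+-suc (J S) u)) (ℕ.+-∸-comm u ∣S∣≤J))))
          (^-homo-* q (J S ∸ ∣ S ∣) u)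
        -- Here k includes the new star, so the n ∸ ∣ S ∣ places number suc n ∸ k, the same as in
        -- the unstarred case.
        places : (suc ∣ S ∣ ≡ᵇ k) ≡ true → unstarred S ≡ suc n ∸ k
        places e = ≡.trans (unstarred≡n∸∣∣ S) (≡.cong (suc n ∸_) (≡ᵇ≡true⇒≡ (suc ∣ S ∣) k e))

    -- Separates the conditions on S from those on the gap, so that for fixed S the sum over p can
    -- be evaluated. Inclusion stands outermost because the exponents inside are exact only under
    -- it.
    split : ∀ p S s → F p S s ≈ guard (S ⊑ᵇ D) (guard (∣ insertAt S p s ∣ ≡ᵇ k)
      (guard (isFree S p) (guard (not s ∨ notLast p) (q ^ ((J S ℕ.+ unstarredFrom S p) ∸ ∣ insertAt S p s ∣)))))
    split p S s rewrite descents-insertAt w p w<M | insert-⊑ᵇ S D p s | unstarredInv-insertAt w S p s w<M = begin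
      guard (a ∧ (b ∧ f)) (guard d x)           ≈⟨ guard-∧ a (b ∧ f) _ ⟩
      guard a (guard (b ∧ f) (guard d x))       ≈⟨ guard-cong a (λ _ → begin
        guard (b ∧ f) (guard d x)                 ≈⟨ guard-comm (b ∧ f) d x ⟩
        guard d (guard (b ∧ f) x)                 ≈⟨ guard-cong d (λ _ → guard-∧ b f x) ⟩
        guard d (guard b (guard f x))             ∎) ⟩
      guard a (guard d (guard b (guard f x)))   ∎
      where
      a = S ⊑ᵇ D
      b = isFree S p
      f = not s ∨ notLast p
      d = ∣ insertAt S p s ∣ ≡ᵇ k
      x = q ^ ((J S ℕ.+ unstarredFrom S p) ∸ ∣ insertAt S p s ∣)

    unstar : ∀ S → sum {suc n} (λ p → F p S false) ≈ N * G S k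
    unstar S = begin
      sum {suc n} (λ p → F p S false)
        ≈⟨ sum-cong (suc n) (λ p → trans (split p S false) (reflexive (≡.cong (λ m → guard (S ⊑ᵇ D) (guard (m ≡ᵇ k)
             (guard (isFree S p) (q ^ ((J S ℕ.+ unstarredFrom S p) ∸ m))))) (∣insertAt∣-false S p)))) ⟩
      sum {suc n} (λ p → guard (S ⊑ᵇ D) (guard (∣ S ∣ ≡ᵇ k) (H p)))
        ≈⟨ guard-sum (S ⊑ᵇ D) (suc n) (λ p → guard (∣ S ∣ ≡ᵇ k) (H p)) ⟨
      guard (S ⊑ᵇ D) (sum {suc n} (λ p → guard (∣ S ∣ ≡ᵇ k) (H p)))
        ≈⟨ guard-cong (S ⊑ᵇ D) (λ S⊑D → trans (sym (guard-sum (∣ S ∣ ≡ᵇ k) (suc n) H)) (unstar-sum S S⊑D)) ⟩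
      guard (S ⊑ᵇ D) (N * guard (∣ S ∣ ≡ᵇ k) (q ^ (J S ∸ ∣ S ∣)))
        ≈⟨ guard-* (S ⊑ᵇ D) _ _ ⟩
      N * G S k ∎
      where
      H : Fin (suc n) → Carrier
      H p = guard (isFree S p) (q ^ ((J S ℕ.+ unstarredFrom S p) ∸ ∣ S ∣))

    prev-G : ∀ k S → guard (S ⊑ᵇ D) (guard (suc ∣ S ∣ ≡ᵇ k) (q ^ (J S ∸ ∣ S ∣))) ≈ prev (G S) k
    prev-G zero    S = guard-0 (S ⊑ᵇ D)
    prev-G (suc k) S = refl

    star : ∀ S → sum {suc n} (λ p → F p S true) ≈ N * prev (G S) k
    star S = begin
      sum {suc n} (λ p → F p S true)
        ≈⟨ sum-cong (suc n) (λ p → trans (split p S true) (reflexive (≡.cong (λ m → guard (S ⊑ᵇ D) (guard (m ≡ᵇ k)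
             (guard (isFree S p) (guard (notLast p) (q ^ ((J S ℕ.+ unstarredFrom S p) ∸ m)))))) (∣insertAt∣-true S p)))) ⟩
      sum {suc n} (λ p → guard (S ⊑ᵇ D) (guard (suc ∣ S ∣ ≡ᵇ k) (H p)))
        ≈⟨ guard-sum (S ⊑ᵇ D) (suc n) (λ p → guard (suc ∣ S ∣ ≡ᵇ k) (H p)) ⟨
      guard (S ⊑ᵇ D) (sum {suc n} (λ p → guard (suc ∣ S ∣ ≡ᵇ k) (H p)))
        ≈⟨ guard-cong (S ⊑ᵇ D) (λ S⊑D → trans (sym (guard-sum (suc ∣ S ∣ ≡ᵇ k) (suc n) H)) (star-sum S S⊑D)) ⟩
      guard (S ⊑ᵇ D) (N * guard (suc ∣ S ∣ ≡ᵇ k) (q ^ (J S ∸ ∣ S ∣)))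
        ≈⟨ guard-* (S ⊑ᵇ D) _ _ ⟩
      N * guard (S ⊑ᵇ D) (guard (suc ∣ S ∣ ≡ᵇ k) (q ^ (J S ∸ ∣ S ∣)))
        ≈⟨ *-congˡ (prev-G k S) ⟩
      N * prev (G S) k ∎
      where
      H : Fin (suc n) → Carrier
      H p = guard (isFree S p) (guard (notLast p) (q ^ ((J S ℕ.+ unstarredFrom S p) ∸ suc ∣ S ∣)))

  -- The common recurrence and the Stirling numbers

  total : ℕ → ℕ → Carrier
  total zero    = elem zero
  total (suc n) k = [ suc n ∸ k ]q * (total n k + prev (total n) k)

  stirling-zero : ∀ {n m} → n ℕ.< m → stirling n m ≈ 0#
  stirling-zero {zero}  {suc m} _         = refl
  stirling-zero {suc n} {suc m} (s≤s n<m) = begin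
    stirling n m + [ suc m ]q * stirling n (suc m)  ≈⟨ +-cong (stirling-zero n<m) (*-congˡ (stirling-zero (ℕ.m≤n⇒m≤1+n n<m))) ⟩
    0# + [ suc m ]q * 0#                            ≈⟨ trans (+-identityˡ _) (zeroʳ _) ⟩
    0#                                              ∎

  -- With m = n-k the two terms are [m]! S(n,m) and [m+1]! S(n,m+1). The factor [m+1] turns their
  -- sum into [m+1]! times the Stirling recurrence for S(n+1,m+1). For k = n+1 both sides vanish.
  total-stirling : ∀ {n k} → k ℕ.≤ n → total n k ≈ [ n ∸ k ]q! * stirling n (n ∸ k)
  total-stirling {zero}  {zero}  _ = sym (*-identityˡ 1#)
  total-stirling {suc n} {k} k≤1+n with ℕ.m≤n⇒m<n∨m≡n k≤1+n
  ... | inj₂ ≡.refl rewrite ℕ.n∸n≡0 n = solve 2 (λ a s → con 0 :* a := con 1 :* (con 0 :+ con 0 :* s)) refl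
          (total n (suc n) + total n n) (stirling n 0)
  ... | inj₁ (s≤s k≤n) rewrite ℕ.+-∸-assoc 1 k≤n = begin
    M * (total n k + prev (total n) k)
      ≈⟨ *-congˡ (+-cong (total-stirling k≤n) (prev-stirling k k≤n)) ⟩
    M * ([ m ]q! * stirling n m + [ m ]q! * M * stirling n (suc m))
      ≈⟨ solve 4 (λ M F a b → M :* (F :* a :+ F :* M :* b) := F :* M :* (a :+ M :* b)) refl M [ m ]q! (stirling n m) (stirling n (suc m)) ⟩
    [ m ]q! * M * (stirling n m + M * stirling n (suc m)) ∎
    where
    m = n ∸ k
    M = [ suc m ]q
    prev-stirling : ∀ k → k ℕ.≤ n → prev (total n) k ≈ [ suc (n ∸ k) ]q! * stirling n (suc (n ∸ k))
    -- The index -1 on the left corresponds to S(n,n+1), which lies outside the triangle.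
    prev-stirling zero    _   = sym (trans (*-congˡ (stirling-zero (ℕ.n<1+n n))) (zeroʳ _))
    prev-stirling (suc k) k<n = ≡.subst (λ i → total n k ≈ [ i ]q! * stirling n i) (ℕ.+-∸-assoc 1 k<n)
      (total-stirling (ℕ.<⇒≤ k<n))

  -- Each permutation of length n+1 is a unique insertion into one of length n, so a recurrence for
  -- the insertions into each single σ sums to that of `total`.
  ∑-permutations : (f : ∀ {n} → ℕ → Word n → Carrier) → (∀ k → f k [] ≈ elem 0 k) →
    (∀ {n} (σ : Word n) k → sum {suc n} (λ p → f k (insertMax σ p)) ≈ [ suc n ∸ k ]q * (f k σ + prev (λ j → f j σ) k)) →
    ∀ n k → ∑ (permutations n) (f k) ≈ total n k
  ∑-permutations f base step zero    k = trans (+-identityʳ _) (base k)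
  ∑-permutations f base step (suc n) k = begin
    ∑ (permutations (suc n)) (f k)
      ≈⟨ ∑-↭ (f k) (permutations-suc n) ⟩
    _
      ≈⟨ ∑-cartesianProductWith insertMax (permutations n) (allFin (suc n)) (f k) ⟩
    ∑ (permutations n) (λ σ → ∑ (allFin (suc n)) (λ p → f k (insertMax σ p)))
      ≈⟨ ∑-cong (permutations n) (λ σ → trans (∑-allFin (suc n) (λ p → f k (insertMax σ p))) (step σ k)) ⟩
    ∑ (permutations n) (λ σ → N * (f k σ + prev (λ j → f j σ) k))
      ≈⟨ trans (∑-*ˡ (permutations n) N _) (*-congˡ (∑-+ (permutations n) _ _)) ⟩
    N * (∑ (permutations n) (f k) + ∑ (permutations n) (λ σ → prev (λ j → f j σ) k))
      ≈⟨ *-congˡ (+-cong (∑-permutations f base step n k) (∑-prev k)) ⟩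
    total (suc n) k ∎
    where
    N = [ suc n ∸ k ]q
    ∑-prev : ∀ k → ∑ (permutations n) (λ σ → prev (λ j → f j σ) k) ≈ prev (total n) k
    ∑-prev zero    = ∑-0 (permutations n) (λ _ → refl)
    ∑-prev (suc k) = ∑-permutations f base step n k

  genFun-𝔖> : ∀ n k (stat : Starred n → ℕ) → genFun (𝔖> n k) stat ≈
    ∑ (permutations n) (λ σ → ∑Subset n (λ S → guard (S ⊑ᵇ descents (map toℕ σ)) (guard (∣ S ∣ ≡ᵇ k) (q ^ stat (σ , S)))))
  genFun-𝔖> n k stat = begin
    genFun (𝔖> n k) stat
      ≈⟨ ∑-filter (isStarred? k) (cartesianProduct words subsets) _ ⟩
    ∑ (cartesianProduct words subsets) (λ x → guard (does (isStarred? k x)) (q ^ stat x))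
      ≈⟨ ∑-cartesianProductWith _,_ words subsets _ ⟩
    ∑ words (λ σ → ∑Subset n (λ S → guard (does (isStarred? k (σ , S))) (q ^ stat (σ , S))))
      ≈⟨ ∑-cong words (λ σ → trans (∑-cong subsets (split σ)) (∑-guard subsets (does (unique? σ)) _)) ⟩
    ∑ words (λ σ → guard (does (unique? σ)) (∑Subset n (λ S → guard (S ⊑ᵇ descents (map toℕ σ)) (guard (∣ S ∣ ≡ᵇ k) (q ^ stat (σ , S))))))
      ≈⟨ ∑-filter unique? words _ ⟨
    _ ∎
    where
    words   = allVecs (allFin n) n
    subsets = allVecs bools n
    split : ∀ σ S → guard (does (isStarred? k (σ , S))) (q ^ stat (σ , S)) ≈
      guard (does (unique? σ)) (guard (S ⊑ᵇ descents (map toℕ σ)) (guard (∣ S ∣ ≡ᵇ k) (q ^ stat (σ , S))))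
    split σ S = trans (guard-∧ (does (unique? σ)) _ _) (guard-cong (does (unique? σ)) (λ _ →
      trans (guard-∧ (does (S ⊆? Des σ)) _ _)
            (guard-congˡ _ (≡.trans (does-⊆? S (Des σ)) (≡.cong (S ⊑ᵇ_) (Des≡descents σ))))))

  ∑-inv★ : ∀ n k → genFun (𝔖> n k) inv★ ≈ total n k
  ∑-inv★ n k = begin
    genFun (𝔖> n k) inv★
      ≈⟨ genFun-𝔖> n k inv★ ⟩
    _ ≈⟨ ∑-cong (permutations n) (λ σ → ∑-cong (allVecs bools n) (λ S → guard-cong (S ⊑ᵇ descents (map toℕ σ)) (λ _ →
           guard-cong (∣ S ∣ ≡ᵇ k) (λ _ → reflexive (≡.cong (q ^_) (inv★≡ σ S)))))) ⟩
    ∑ (permutations n) (λ σ → invSum k (map toℕ σ))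
      ≈⟨ ∑-permutations (λ k σ → invSum k (map toℕ σ)) base step n k ⟩
    total n k ∎
    where
    base : ∀ k → invSum k [] ≈ elem 0 k
    base zero    = +-identityʳ 1#
    base (suc k) = +-identityʳ 0#
    step : ∀ {n} (σ : Word n) k → sum {suc n} (λ p → invSum k (map toℕ (insertMax σ p))) ≈
      [ suc n ∸ k ]q * (invSum k (map toℕ σ) + prev (λ j → invSum j (map toℕ σ)) k)
    step {n} σ k = trans (sum-cong (suc n) (λ p → reflexive (≡.cong (invSum k) (toℕ-insertMax σ p))))
      (invSum-insert (map toℕ σ) k (letters< σ))

  ∑-maj★ : ∀ n k → genFun (𝔖> n k) maj★ ≈ total n k
  ∑-maj★ n k = begin
    genFun (𝔖> n k) maj★
      ≈⟨ genFun-𝔖> n k maj★ ⟩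
    _ ≈⟨ ∑-cong (permutations n) (λ σ → ∑-cong (allVecs bools n) (λ S → guard-cong (S ⊑ᵇ descents (map toℕ σ)) (λ _ →
           guard-cong (∣ S ∣ ≡ᵇ k) (λ _ → reflexive (≡.cong (q ^_) (≡.trans (maj★≡ σ S) (≡.cong (λ D → starredMaj D S) (Des≡descents σ)))))))) ⟩
    ∑ (permutations n) (λ σ → majSum k (descents (map toℕ σ)))
      ≈⟨ ∑-permutations (λ k σ → majSum k (descents (map toℕ σ))) (λ k → trans (majSum-elem [] k) (*-identityˡ _)) step n k ⟩
    total n k ∎
    where
    step : ∀ {n} (σ : Word n) k → sum {suc n} (λ p → majSum k (descents (map toℕ (insertMax σ p)))) ≈
      [ suc n ∸ k ]q * (majSum k (descents (map toℕ σ)) + prev (λ j → majSum j (descents (map toℕ σ))) k)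
    step {n} σ k = trans
      (sum-cong (suc n) (λ p → reflexive (≡.cong (majSum k)
        (≡.trans (≡.cong descents (toℕ-insertMax σ p)) (descents-insertAt (map toℕ σ) p (letters< σ))))))
      (majSum-insert (descents (map toℕ σ)) k (descents-lastOut (map toℕ σ)))

  -- Filling the staircase board

  -- The sum over the ways to fill r columns with k non-attacking rooks, when the first of these columns has b + 1
  -- cells left.
  rookSum : ℕ → ℕ → ℕ → Carrier
  rookSum zero    b k = elem 0 k
  rookSum (suc r) b k = [ suc b ]q * rookSum r (suc b) k + [ b ]q * prev (rookSum r b) k

  -- The last of the r+1 columns is split off instead of the first. It has b+r+1 cells, less one for
  -- each earlier non-attacking rook. A file rook there follows k of these; a non-attacking one
  -- follows k-1, hence finds one more cell, but loses the bottom one. Both give the factor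
  -- [b+r+1-k].
  rookSum-suc : ∀ r b k → rookSum (suc r) b k ≈ [ (b ℕ.+ suc r) ∸ k ]q * (rookSum r b k + prev (rookSum r b) k)
  rookSum-suc zero b zero rewrite ℕ.+-comm b 1 =
    solve 2 (λ x y → x :* con 1 :+ y :* con 0 := x :* (con 1 :+ con 0)) refl [ suc b ]q [ b ]q
  rookSum-suc zero b (suc zero) rewrite ℕ.+-comm b 1 =
    solve 2 (λ x y → x :* con 0 :+ y :* con 1 := y :* (con 0 :+ con 1)) refl [ suc b ]q [ b ]q
  rookSum-suc zero b (suc (suc k)) =
    solve 3 (λ x y z → x :* con 0 :+ y :* con 0 := z :* (con 0 :+ con 0)) refl [ suc b ]q [ b ]q _
  rookSum-suc (suc r) b zero = begin
    [ suc b ]q * rookSum (suc r) (suc b) 0 + [ b ]q * 0#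
      ≈⟨ +-congʳ (*-congˡ (rookSum-suc r (suc b) 0)) ⟩
    [ suc b ]q * ([ suc b ℕ.+ suc r ]q * (rookSum r (suc b) 0 + 0#)) + [ b ]q * 0#
      ≈⟨ solve 4 (λ x y z a → x :* (z :* (a :+ con 0)) :+ y :* con 0 := z :* (x :* a :+ y :* con 0 :+ con 0))
           refl [ suc b ]q [ b ]q [ suc b ℕ.+ suc r ]q (rookSum r (suc b) 0) ⟩
    [ suc b ℕ.+ suc r ]q * (rookSum (suc r) b 0 + 0#)
      ≡⟨ ≡.cong (λ m → [ m ]q * (rookSum (suc r) b 0 + 0#)) (≡.sym (ℕ.+-suc b (suc r))) ⟩
    [ b ℕ.+ suc (suc r) ]q * (rookSum (suc r) b 0 + 0#) ∎
  rookSum-suc (suc r) b (suc k) = begin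
    [ suc b ]q * rookSum (suc r) (suc b) (suc k) + [ b ]q * rookSum (suc r) b k
      ≈⟨ +-cong (*-congˡ (rookSum-suc r (suc b) (suc k))) (*-congˡ (rookSum-suc r b k)) ⟩
    [ suc b ]q * (N * (a + a′)) + [ b ]q * (N * (e + e′))
      ≈⟨ solve 7 (λ x y z a a′ e e′ → x :* (z :* (a :+ a′)) :+ y :* (z :* (e :+ e′)) := z :* ((x :* a :+ y :* e) :+ (x :* a′ :+ y :* e′)))
           refl [ suc b ]q [ b ]q N a a′ e e′ ⟩
    N * (rookSum (suc r) b (suc k) + rookSum (suc r) b k)
      ≡⟨ ≡.cong (λ m → [ m ∸ suc k ]q * (rookSum (suc r) b (suc k) + rookSum (suc r) b k)) (≡.sym (ℕ.+-suc b (suc r))) ⟩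
    [ (b ℕ.+ suc (suc r)) ∸ suc k ]q * (rookSum (suc r) b (suc k) + rookSum (suc r) b k) ∎
    where
    N = [ (b ℕ.+ suc r) ∸ k ]q
    a = rookSum r (suc b) (suc k)
    a′ = rookSum r (suc b) k
    e = rookSum r b k
    e′ = prev (rookSum r b) k

  rookSum-total : ∀ n k → rookSum n 0 k ≈ total n k
  rookSum-total zero    k = refl
  rookSum-total (suc n) k = trans (rookSum-suc n 0 k) (*-congˡ (+-cong (rookSum-total n k) (prev-total k)))
    where
    prev-total : ∀ k → prev (rookSum n 0) k ≈ prev (total n) k
    prev-total zero    = refl
    prev-total (suc k) = rookSum-total n k

  -- From bottom to top the rows of B have the ranks 0, 1, 2, and so on, each once.
  sum-rank : ∀ {N} (B : Rows N) → sum (λ r → guard (B r) (q ^ rank B r)) ≈ [ size B ]q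
  sum-rank {zero}  B = refl
  sum-rank {suc N} B with B zero
  ... | false = trans (+-identityˡ _) (sum-rank (B ∘ suc))
  ... | true  = begin
    _
      ≈⟨ +-cong (reflexive (≡.cong (q ^_) (ℕΣ.sum-zero N {λ _ → 0} (λ _ → ≡.refl))))
           (trans (sum-cong N (λ r → guard-* (B (suc r)) q _)) (sum-*ˡ N q (λ r → guard (B (suc r)) (q ^ rank (B ∘ suc) r)))) ⟩
    1# + q * sum (λ r → guard (B (suc r)) (q ^ rank (B ∘ suc) r))
      ≈⟨ +-congˡ (*-congˡ (sum-rank (B ∘ suc))) ⟩
    1# + q * [ size (B ∘ suc) ]q
      ≈⟨ []q-suc (size (B ∘ suc)) ⟨
    [ suc (size (B ∘ suc)) ]q ∎

  module _ {N : ℕ} where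

    placementSum : ∀ r → ℕ → Rows N → ℕ → Carrier
    placementSum r m A k = ∑ (allVecs (cells N) r) (λ v → guard (valid m A v) (guard (#N v ≡ᵇ k) (q ^ uncFrom A v)))

    columnSum : ℕ → Rows N → Kind → Carrier
    columnSum m A t = sum (λ r → guard ((toℕ r <ᵇ suc m) ∧ (A r ∧ allowed t r)) (q ^ rank (λ x → A x ∧ allowed t x) r))

    -- All rows below a rook on the board meet the board in that column, so discarding the rows
    -- above m changes no rank that occurs in the sum.
    columnSum-size : ∀ m A t → columnSum m A t ≈ [ size (upTo[ suc m ] (λ x → A x ∧ allowed t x)) ]q
    columnSum-size m A t = trans (sum-cong N (λ r → guard-cong (B r) (λ e → reflexive (≡.cong (q ^_) (rank≡ r e))))) (sum-rank B)
      where
      B : Rows N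
      B = upTo[ suc m ] (λ x → A x ∧ allowed t x)
      rank≡ : ∀ r → B r ≡ true → rank (λ x → A x ∧ allowed t x) r ≡ rank B r
      rank≡ r e = ℕΣ.sum-cong N (λ x → ≡.cong ⟦_⟧ (bit x))
        where
        r<m : toℕ r ℕ.< suc m
        r<m = <ᵇ≡true⇒< (toℕ r) (suc m) (proj₁ (∧≡true⁻ (toℕ r <ᵇ suc m) e))
        bit : ∀ x → (toℕ x <ᵇ toℕ r) ∧ (A x ∧ allowed t x) ≡ (toℕ x <ᵇ toℕ r) ∧ B x
        bit x with toℕ x <ᵇ toℕ r in x<r
        ... | false = ≡.refl
        ... | true rewrite <⇒<ᵇ≡true (ℕ.<-trans (<ᵇ≡true⇒< (toℕ x) (toℕ r) x<r) r<m) = ≡.refl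

    -- Row m enters the board with column m, so no earlier rook can have cancelled it.
    record Available (m b : ℕ) (A : Rows N) : Set where
      field
        bottom : ∀ x → toℕ x ≡ 0 → A x ≡ true
        above  : ∀ x → m ℕ.≤ toℕ x → A x ≡ true
        count  : size (upTo[ m ] A) ≡ b

    open Available

    size-file : ∀ {m b A} → m ℕ.< N → Available m b A → size (upTo[ suc m ] (λ x → A x ∧ true)) ≡ suc b
    size-file {m} {b} {A} m<N av = ≡.trans (size-cong (λ x → ≡.cong ((toℕ x <ᵇ suc m) ∧_) (∧-identityʳ (A x))))
      (≡.trans (size-upTo-suc m A m<N (above av)) (≡.cong suc (count av)))

    available-file : ∀ {m b A} r → m ℕ.< N → Available m b A → Available (suc m) (suc b) (place file r A)
    available-file {m} {b} {A} r m<N av = record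
      { bottom = bottom av
      ; above  = λ x m<x → above av x (ℕ.<⇒≤ m<x)
      ; count  = ≡.trans (size-upTo-suc m A m<N (above av)) (≡.cong suc (count av))
      }

    -- Row m becomes reachable and row r is lost, so the count stays at b. The rook is neither in
    -- the bottom row nor above row m, which preserves the other two conditions.
    available-nonAttacking : ∀ {m b A} r → m ℕ.< N → (toℕ r <ᵇ suc m) ∧ (A r ∧ allowed nonAttacking r) ≡ true →
      Available m b A → Available (suc m) b (place nonAttacking r A)
    available-nonAttacking {m} {b} {A} r m<N e av
      with r<m , e₁ ← ∧≡true⁻ (toℕ r <ᵇ suc m) e
      with Ar , 0<r ← ∧≡true⁻ (A r) e₁
      = record
      { bottom = λ x x≡0 → place⁺ nonAttacking r A x (bottom av x x≡0)
          (λ { _ ≡.refl → contradiction (<ᵇ≡true⇒< 0 (toℕ r) 0<r) (λ lt → ℕ.<-irrefl (≡.sym x≡0) lt) })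
      ; above  = λ x m<x → place⁺ nonAttacking r A x (above av x (ℕ.<⇒≤ m<x))
          (λ { _ ≡.refl → ℕ.<⇒≱ m<x (ℕ.≤-pred (<ᵇ≡true⇒< (toℕ r) (suc m) r<m)) })
      ; count  = ℕ.suc-injective (≡.trans (≡.sym (size-upTo-place (suc m) A r (∧≡true⁺ r<m Ar)))
          (≡.trans (size-upTo-suc m A m<N (above av)) (≡.cong suc (count av))))
      }

  -- The bottom row is always open, and it is the one row that a non-attacking rook may not use: one
  -- choice fewer than for a file rook.
  size-nonAttacking : ∀ {N m b} {A : Rows N} → m ℕ.< N → Available m b A →
                      size (upTo[ suc m ] (λ x → A x ∧ allowed nonAttacking x)) ≡ b
  size-nonAttacking {suc N} {m} {b} {A} m<N av = ℕ.suc-injective (≡.trans split (size-file m<N av))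
    where
    open Available av
    split : suc (size (upTo[ suc m ] (λ x → A x ∧ allowed nonAttacking x))) ≡ size (upTo[ suc m ] (λ x → A x ∧ true))
    split rewrite bottom zero ≡.refl = ≡.refl

  -- The later columns see the state A only through b. Their sum is therefore the same for every
  -- admissible row of the rook in column m, and the sum over these rows factors out as a q-integer.
  placementSum-rookSum : ∀ {N} r m {b} {A : Rows N} k → m ℕ.+ r ≡ N → Available m b A → placementSum r m A k ≈ rookSum r b k
  placementSum-rookSum zero    m zero    _   _  = +-identityʳ 1#
  placementSum-rookSum zero    m (suc k) _   _  = +-identityʳ 0#
  placementSum-rookSum {N} (suc r) m {b} {A} k m+r av = begin
    placementSum (suc r) m A k
      ≈⟨ ∑-allVecs-suc (cells N) {r} _ ⟩
    ∑ (cells N) (λ e → ∑ placements (λ v → F (e ∷ v)))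
      ≈⟨ ∑-cartesianProductWith _,_ (nonAttacking ∷ file ∷ []) (allFin N) _ ⟩
    ∑ (allFin N) (λ x → ∑ placements (λ v → F ((nonAttacking , x) ∷ v)))
      + (∑ (allFin N) (λ x → ∑ placements (λ v → F ((file , x) ∷ v))) + 0#)
      ≈⟨ +-cong (∑-allFin N _) (trans (+-identityʳ _) (∑-allFin N _)) ⟩
    sum (λ x → ∑ placements (λ v → F ((nonAttacking , x) ∷ v)))
      + sum (λ x → ∑ placements (λ v → F ((file , x) ∷ v)))
      ≈⟨ +-cong (column nonAttacking (prev (rookSum r b) k) (λ x e → nonAttacking-rest k x e))
                (column file (rookSum r (suc b) k) (λ x _ → placementSum-rookSum r (suc m) k m+r′ (available-file x m<N av))) ⟩
    columnSum m A nonAttacking * prev (rookSum r b) k + columnSum m A file * rookSum r (suc b) k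
      ≈⟨ +-comm _ _ ⟩
    columnSum m A file * rookSum r (suc b) k + columnSum m A nonAttacking * prev (rookSum r b) k
      ≈⟨ +-cong (*-congʳ (trans (columnSum-size m A file) (reflexive (≡.cong [_]q (size-file m<N av)))))
                (*-congʳ (trans (columnSum-size m A nonAttacking) (reflexive (≡.cong [_]q (size-nonAttacking m<N av))))) ⟩
    rookSum (suc r) b k ∎
    where
    placements = allVecs (cells N) r
    F : Vec (Kind × Fin N) (suc r) → Carrier
    F v = guard (valid m A v) (guard (#N v ≡ᵇ k) (q ^ uncFrom A v))
    m+r′ : suc m ℕ.+ r ≡ N
    m+r′ = ≡.trans (≡.sym (ℕ.+-suc m r)) m+r
    m<N : m ℕ.< N
    m<N = ℕ.≤-trans (s≤s (ℕ.m≤m+n m r)) (ℕ.≤-reflexive m+r′)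
    cell : Kind → Fin N → Bool
    cell t x = (toℕ x <ᵇ suc m) ∧ (A x ∧ allowed t x)
    G : ∀ t → Fin N → Carrier
    G t x = ∑ placements (λ v → guard (valid (suc m) (place t x A) v) (guard (#N ((t , x) ∷ v) ≡ᵇ k) (q ^ uncFrom (place t x A) v)))
    nonAttacking-rest : ∀ k x → cell nonAttacking x ≡ true →
      ∑ placements (λ v → guard (valid (suc m) (place nonAttacking x A) v)
        (guard (suc (#N v) ≡ᵇ k) (q ^ uncFrom (place nonAttacking x A) v))) ≈ prev (rookSum r b) k
    nonAttacking-rest zero    x e = ∑-0 placements (λ v → guard-0 (valid (suc m) (place nonAttacking x A) v))
    nonAttacking-rest (suc k) x e = placementSum-rookSum r (suc m) k m+r′ (available-nonAttacking x m<N e av)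
    column : ∀ t y → (∀ x → cell t x ≡ true → G t x ≈ y) →
             sum (λ x → ∑ placements (λ v → F ((t , x) ∷ v))) ≈ columnSum m A t * y
    column t y rest = begin
      sum (λ x → ∑ placements (λ v → F ((t , x) ∷ v)))
        ≈⟨ sum-cong N (λ x → begin
          ∑ placements (λ v → F ((t , x) ∷ v))
            ≈⟨ ∑-cong placements (pull x) ⟩
          ∑ placements (λ v → guard (cell t x) (q ^ ρ x * H x v))
            ≈⟨ ∑-guard placements (cell t x) _ ⟩
          guard (cell t x) (∑ placements (λ v → q ^ ρ x * H x v))
            ≈⟨ guard-cong (cell t x) (λ e → trans (∑-*ˡ placements (q ^ ρ x) (H x)) (trans (*-congˡ (rest x e)) (*-comm _ y))) ⟩
          guard (cell t x) (y * q ^ ρ x)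
            ≈⟨ guard-* (cell t x) y _ ⟩
          y * guard (cell t x) (q ^ ρ x) ∎) ⟩
      sum (λ x → y * guard (cell t x) (q ^ ρ x))
        ≈⟨ sum-*ˡ N y (λ x → guard (cell t x) (q ^ ρ x)) ⟩
      y * columnSum m A t
        ≈⟨ *-comm _ _ ⟩
      columnSum m A t * y ∎
      where
      ρ : Fin N → ℕ
      ρ = rank (λ x → A x ∧ allowed t x)
      H : Fin N → Vec (Kind × Fin N) r → Carrier
      H x v = guard (valid (suc m) (place t x A) v) (guard (#N ((t , x) ∷ v) ≡ᵇ k) (q ^ uncFrom (place t x A) v))
      pull : ∀ x v → F ((t , x) ∷ v) ≈ guard (cell t x) (q ^ ρ x * H x v)
      pull x v = trans (guard-∧ (cell t x) w _) (guard-cong (cell t x) (λ _ →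
        trans (guard-cong w (λ _ → trans (guard-cong n (λ _ → ^-homo-* q (ρ x) _)) (guard-* n _ _))) (guard-* w _ _)))
        where
        w = valid (suc m) (place t x A) v
        n = #N ((t , x) ∷ v) ≡ᵇ k

  ∑-unc : ∀ n k → genFun (𝓜 n k) unc ≈ total n k
  ∑-unc n k = begin
    genFun (𝓜 n k) unc
      ≈⟨ ∑-filter (isMixed? k) (allVecs (cells n) n) _ ⟩
    ∑ (allVecs (cells n) n) (λ P → guard (does (isMixed? k P)) (q ^ unc P))
      ≈⟨ ∑-cong (allVecs (cells n) n) (λ P → trans (guard-congˡ _ (does-isMixed? k P)) (trans (guard-∧ (valid 0 allRows P) _ _)
           (guard-cong (valid 0 allRows P) (λ e → reflexive (≡.cong (λ u → guard (#N P ≡ᵇ k) (q ^ u)) (unc≡uncFrom P e)))))) ⟩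
    placementSum n 0 allRows k
      ≈⟨ placementSum-rookSum n 0 k ≡.refl (record
           { bottom = λ _ _ → ≡.refl ; above = λ _ _ → ≡.refl ; count = ℕΣ.sum-zero n {λ _ → 0} (λ _ → ≡.refl) }) ⟩
    rookSum n 0 k
      ≈⟨ rookSum-total n k ⟩
    total n k ∎

theorem4p2p1 : ∀ {c ℓ} (R : CommutativeSemiring c ℓ) (q : CommutativeSemiring.Carrier R) →
    let open CommutativeSemiring R
        open QAnalogue R q
    in (n k : ℕ) → 1 ≤ n → k ≤ n ∸ 1 →
       (genFun (𝔖> n k) inv★ ≈ genFun (𝔖> n k) maj★) ×
       (genFun (𝔖> n k) maj★ ≈ genFun (𝓜 n k) unc) ×
       (genFun (𝓜 n k) unc ≈ [ n ∸ k ]q! * stirling n (n ∸ k))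
theorem4p2p1 R q n k _ k≤n-1 =
  trans (∑-inv★ n k) (sym (∑-maj★ n k)) ,
  trans (∑-maj★ n k) (sym (∑-unc n k)) ,
  trans (∑-unc n k) (total-stirling (ℕ.≤-trans k≤n-1 (ℕ.m∸n≤m n 1)))
  where
  open CommutativeSemiring R using (trans; sym)
  open GeneratingFunctions R q
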